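{- If $\tau \in \{1200,1220,1230\}$, then $$f_\tau(x)=\frac{1-7x+17x^2-16x^3+5x^4-x^5}{(1-2x)(1-3x+x^2)^2}$$ as formal power series in $x$, where $f_\tau(x)=\sum_{n\ge 0} b_n(\tau)x^n$ and $b_n(\tau)$ is the number of ascent sequences of length $n$ that avoid both patterns $021$ and $\tau$.
   Context: For a finite sequence $w=w_1\cdots w_n$ of integers, $\mathrm{asc}(w)$ is the number of indices $1\le i\le n-1$ with $w_i<w_{i+1}$. An ascent sequence of length $n\ge 1$ is a sequence $a_1\cdots a_n$ of non-negative integers such that $a_1=0$ and $a_i\le \mathrm{asc}(a_1\cdots a_{i-1})+1$ for $1<i\le n$; there is exactly one (empty) ascent sequence of length $0$. A sequence $\pi=\pi_1\cdots\pi_n$ contains a pattern $\tau=\tau_1\cdots\tau_m$ if there are indices $1\le i_1<\cdots<i_m\le n$ such that for all $j,k\in\{1,\dots,m\}$: $\pi_{i_j}<\pi_{i_k}$ iff $\tau_j<\tau_k$, and $\pi_{i_j}=\pi_{i_k}$ iff $\tau_j=\tau_k$; otherwise $\pi$ avoids $\tau$. For a pattern $\tau$, $B_n(\tau)$ is the set of ascent sequences of length $n$ avoiding both $021$ and $\tau$ (with $B_0(\tau)$ consisting of the empty sequence), and $b_n(\tau)=|B_n(\tau)|$. -}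

module Defs where

open import Data.Bool using (true; false; if_then_else_)
open import Data.Fin using (Fin; zero; suc; toℕ; finToFun; funToFin)
  renaming (_<_ to _<ᶠ_; _<?_ to _<ᶠ?_)
open import Data.Fin.Properties using (any?; all?; finToFun-funToFin; toℕ<n)
open import Data.Integer as ℤ using (ℤ; +_; 0ℤ; 1ℤ)
import Data.Integer.Properties as ℤ
open import Data.Integer.Tactic.RingSolver using (solve-∀)
open import Data.List
  using (List; []; _∷_; length; lookup; take; filter; upTo; applyUpTo; foldr; cartesianProductWith)
open import Data.List.Properties using (length-take; ∷-injective)
open import Data.List.Membership.Propositional using (_∈_)
open import Data.List.Membership.Propositional.Properties
  using (∈-cartesianProductWith⁺; ∈-filter⁺; ∈-filter⁻; ∈-upTo⁺)
open import Data.List.Relation.Unary.All using ([])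
open import Data.List.Relation.Unary.AllPairs using ([]; _∷_)
open import Data.List.Relation.Unary.Any using (here)
open import Data.List.Relation.Unary.Unique.Propositional using (Unique)
import Data.List.Relation.Unary.Unique.Propositional.Properties as Unique
open import Data.Nat using (ℕ; zero; suc; _+_; _∸_; _⊓_; _≤_; _<_; _<ᵇ_; _≤?_; _<?_; _≟_; z≤n; s≤s)
import Data.Nat.Properties as ℕ
open import Data.Product using (∃; _×_; _,_; proj₁; proj₂)
open import Function using (_∘_; _⇔_; mk⇔; Equivalence)
open import Relation.Binary.PropositionalEquality
open import Relation.Nullary using (Dec; ¬_)
open import Relation.Nullary.Decidable using (map′; _×-dec_; _→-dec_; ¬?)
open import Relation.Unary using (Pred; Decidable)

asc : List ℕ → ℕ
asc []          = 0
asc (x ∷ [])    = 0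
asc (x ∷ y ∷ w) = if x <ᵇ y then suc (asc (y ∷ w)) else asc (y ∷ w)

-- Positions are 0-based, so the letters preceding position i are take (toℕ i) a.
record IsAscentSequence (a : List ℕ) : Set where
  field
    first : ∀ (i : Fin (length a)) → toℕ i ≡ 0 → lookup a i ≡ 0
    bound : ∀ (i : Fin (length a)) → 0 < toℕ i → lookup a i ≤ asc (take (toℕ i) a) + 1

IsOccurrence : (π τ : List ℕ) → (Fin (length τ) → Fin (length π)) → Set
IsOccurrence π τ ι =
  (∀ j k → j <ᶠ k → ι j <ᶠ ι k) ×
  (∀ j k → (lookup π (ι j) < lookup π (ι k)) ⇔ (lookup τ j < lookup τ k)) ×
  (∀ j k → (lookup π (ι j) ≡ lookup π (ι k)) ⇔ (lookup τ j ≡ lookup τ k))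

Contains : (π τ : List ℕ) → Set
Contains π τ = ∃ (IsOccurrence π τ)

Avoids : (π τ : List ℕ) → Set
Avoids π τ = ¬ Contains π τ

record B (τ : List ℕ) (n : ℕ) (a : List ℕ) : Set where
  field
    length≡n         : length a ≡ n
    isAscentSequence : IsAscentSequence a
    avoids-021       : Avoids a (0 ∷ 2 ∷ 1 ∷ [])
    avoids-τ         : Avoids a τ

record Enumeration {A : Set} (P : Pred A _) : Set where
  field
    elements : List A
    unique   : Unique elements
    exact    : ∀ x → x ∈ elements ⇔ P x

  cardinality : ℕ
  cardinality = length elements

infixr 2 _⇔-dec_

_⇔-dec_ : {P Q : Set} → Dec P → Dec Q → Dec (P ⇔ Q)
p? ⇔-dec q? =
  map′ (λ (f , g) → mk⇔ f g) (λ e → Equivalence.to e , Equivalence.from e)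
       ((p? →-dec q?) ×-dec (q? →-dec p?))

isAscentSequence? : Decidable IsAscentSequence
isAscentSequence? a =
  map′ (λ (f , b) → record { first = f ; bound = b }) (λ r → first r , bound r)
    (all? (λ i → (toℕ i ≟ 0) →-dec (lookup a i ≟ 0)) ×-dec
     all? (λ i → (0 <? toℕ i) →-dec (lookup a i ≤? asc (take (toℕ i) a) + 1)))
  where open IsAscentSequence

isOccurrence? : ∀ π τ → Decidable (IsOccurrence π τ)
isOccurrence? π τ ι =
  (all? λ j → all? λ k → (j <ᶠ? k) →-dec (ι j <ᶠ? ι k)) ×-dec
  (all? λ j → all? λ k → (lookup π (ι j) <? lookup π (ι k)) ⇔-dec (lookup τ j <? lookup τ k)) ×-dec
  (all? λ j → all? λ k → (lookup π (ι j) ≟ lookup π (ι k)) ⇔-dec (lookup τ j ≟ lookup τ k))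

IsOccurrence-resp-≗ : ∀ π τ {ι κ} → ι ≗ κ → IsOccurrence π τ ι → IsOccurrence π τ κ
IsOccurrence-resp-≗ π τ {ι} {κ} eq (inc , lt , e) =
  (λ j k → subst₂ (λ x y → j <ᶠ k → x <ᶠ y) (eq j) (eq k) (inc j k)) ,
  (λ j k → subst₂ (λ x y → (lookup π x < lookup π y) ⇔ (lookup τ j < lookup τ k)) (eq j) (eq k) (lt j k)) ,
  (λ j k → subst₂ (λ x y → (lookup π x ≡ lookup π y) ⇔ (lookup τ j ≡ lookup τ k)) (eq j) (eq k) (e j k))

contains? : ∀ π τ → Dec (Contains π τ)
contains? π τ =
  map′ (λ (c , occ) → finToFun c , occ)
       (λ (ι , occ) → funToFin ι ,
          IsOccurrence-resp-≗ π τ (sym ∘ finToFun-funToFin ι) occ)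
       (any? (λ c → isOccurrence? π τ (finToFun c)))

B? : ∀ τ n → Decidable (B τ n)
B? τ n a =
  map′ (λ (l , s , p , q) → record
          { length≡n = l ; isAscentSequence = s ; avoids-021 = p ; avoids-τ = q })
       (λ r → length≡n r , isAscentSequence r , avoids-021 r , avoids-τ r)
       ((length a ≟ n) ×-dec isAscentSequence? a ×-dec
        ¬? (contains? a (0 ∷ 2 ∷ 1 ∷ [])) ×-dec ¬? (contains? a τ))
  where open B

words : (m n : ℕ) → List (List ℕ)
words m zero    = [] ∷ []
words m (suc n) = cartesianProductWith _∷_ (upTo m) (words m n)

words-unique : ∀ m n → Unique (words m n)
words-unique m zero    = [] ∷ []
words-unique m (suc n) =
  Unique.cartesianProductWith⁺ _∷_ ∷-injective (Unique.upTo⁺ m) (words-unique m n)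

∈-words : ∀ m a → (∀ i → lookup a i < m) → a ∈ words m (length a)
∈-words m []      _  = here refl
∈-words m (x ∷ a) lt =
  ∈-cartesianProductWith⁺ _∷_ (∈-upTo⁺ (lt zero)) (∈-words m a (lt ∘ suc))

asc-∷ : ∀ x w → asc (x ∷ w) ≤ length w
asc-∷ x []      = z≤n
asc-∷ x (y ∷ w) with x <ᵇ y
... | true  = s≤s (asc-∷ y w)
... | false = ℕ.m≤n⇒m≤1+n (asc-∷ y w)

ascent-letter<length : ∀ {a} → IsAscentSequence a → ∀ i → lookup a i < length a
ascent-letter<length {x ∷ a} s zero    =
  subst (_< suc (length a)) (sym (IsAscentSequence.first s zero refl)) (s≤s z≤n)
ascent-letter<length {x ∷ a} s (suc i) = s≤s (begin
  lookup a i                    ≤⟨ IsAscentSequence.bound s (suc i) (s≤s z≤n) ⟩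
  asc (x ∷ take (toℕ i) a) + 1  ≤⟨ ℕ.+-monoˡ-≤ 1 (asc-∷ x (take (toℕ i) a)) ⟩
  length (take (toℕ i) a) + 1   ≡⟨ cong (_+ 1) (length-take (toℕ i) a) ⟩
  (toℕ i ⊓ length a) + 1        ≤⟨ ℕ.+-monoˡ-≤ 1 (ℕ.m⊓n≤m (toℕ i) (length a)) ⟩
  toℕ i + 1                     ≡⟨ ℕ.+-comm (toℕ i) 1 ⟩
  suc (toℕ i)                   ≤⟨ toℕ<n i ⟩
  length a                      ∎)
  where open ℕ.≤-Reasoning

filter-enumeration : ∀ {A : Set} {P : Pred A _} → Decidable P → (xs : List A) →
  Unique xs → (∀ {x} → P x → x ∈ xs) → Enumeration P
filter-enumeration P? xs xs! P⊆xs = record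
  { elements = filter P? xs
  ; unique   = Unique.filter⁺ P? xs!
  ; exact    = λ x → mk⇔ (λ x∈ → proj₂ (∈-filter⁻ P? {xs = xs} x∈))
                         (λ Px → ∈-filter⁺ P? (P⊆xs Px) Px)
  }

B⇒∈words : ∀ τ n {a} → B τ n a → a ∈ words n n
B⇒∈words τ n {a} record { length≡n = refl ; isAscentSequence = s } =
  ∈-words (length a) a (ascent-letter<length s)

B-enumeration : ∀ τ n → Enumeration (B τ n)
B-enumeration τ n =
  filter-enumeration (B? τ n) (words n n) (words-unique n n) (B⇒∈words τ n)

b : List ℕ → ℕ → ℕ
b τ n = Enumeration.cardinality (B-enumeration τ n)

-- Formal power series over ℤ, as coefficient sequences; equality of series is _≗_.
Series : Set
Series = ℕ → ℤ

infixl 7 _·_ _/_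
infixr 8 _^_

-- Cauchy product: the coefficient of xⁿ is the sum of f k * g (n ∸ k) over 0 ≤ k ≤ n.
_·_ : Series → Series → Series
(f · g) n = foldr ℤ._+_ 0ℤ (applyUpTo (λ k → f k ℤ.* g (n ∸ k)) (suc n))

-- The polynomial with the given coefficients, constant term first.
poly : List ℤ → Series
poly []       n       = 0ℤ
poly (c ∷ cs) zero    = c
poly (c ∷ cs) (suc n) = poly cs n

_^_ : Series → ℕ → Series
f ^ zero  = poly (1ℤ ∷ [])
f ^ suc m = f · f ^ m

-- Long division by a series with constant term 1: the constant term of p / q
-- is p 0, and the rest is the quotient by q of (p - p 0 q) divided by x.
-- By /-·-cancel and /-unique, p / q is the only series whose product with q is p.
_/_ : (p q : Series) → .⦃ q 0 ≡ 1ℤ ⦄ → Series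
(p / q) zero    = p 0
(p / q) (suc n) = ((λ k → p (suc k) ℤ.- p 0 ℤ.* q (suc k)) / q) n

/-·-cancel : ∀ p q ⦃ q₀≡1 : q 0 ≡ 1ℤ ⦄ → (p / q) · q ≗ p
/-·-cancel p q ⦃ q₀≡1 ⦄ zero = begin
  p 0 ℤ.* q 0 ℤ.+ 0ℤ  ≡⟨ ℤ.+-identityʳ _ ⟩
  p 0 ℤ.* q 0         ≡⟨ cong (p 0 ℤ.*_) q₀≡1 ⟩
  p 0 ℤ.* 1ℤ          ≡⟨ ℤ.*-identityʳ _ ⟩
  p 0                 ∎
  where open ≡-Reasoning
/-·-cancel p q (suc n) = begin
  p 0 ℤ.* q (suc n) ℤ.+ ((r / q) · q) n  ≡⟨ cong (λ z → p 0 ℤ.* q (suc n) ℤ.+ z) (/-·-cancel r q n) ⟩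
  p 0 ℤ.* q (suc n) ℤ.+ r n              ≡⟨ lemma (p 0 ℤ.* q (suc n)) (p (suc n)) ⟩
  p (suc n)                              ∎
  where
  open ≡-Reasoning
  r : Series
  r k = p (suc k) ℤ.- p 0 ℤ.* q (suc k)
  lemma : ∀ x y → x ℤ.+ (y ℤ.- x) ≡ y
  lemma = solve-∀

/-unique : ∀ f p q ⦃ q₀≡1 : q 0 ≡ 1ℤ ⦄ → f · q ≗ p → f ≗ p / q
/-unique f p q ⦃ q₀≡1 ⦄ eq = go
  where
  open ≡-Reasoning
  f₀≡p₀ : f 0 ≡ p 0
  f₀≡p₀ = begin
    f 0                 ≡⟨ ℤ.*-identityʳ _ ⟨
    f 0 ℤ.* 1ℤ          ≡⟨ cong (f 0 ℤ.*_) q₀≡1 ⟨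
    f 0 ℤ.* q 0         ≡⟨ ℤ.+-identityʳ _ ⟨
    f 0 ℤ.* q 0 ℤ.+ 0ℤ  ≡⟨ eq 0 ⟩
    p 0                 ∎
  r : Series
  r k = p (suc k) ℤ.- p 0 ℤ.* q (suc k)
  lemma : ∀ x y → y ≡ (x ℤ.+ y) ℤ.- x
  lemma = solve-∀
  tail-eq : (f ∘ suc) · q ≗ r
  tail-eq n = begin
    ((f ∘ suc) · q) n                                              ≡⟨ lemma (f 0 ℤ.* q (suc n)) _ ⟩
    (f 0 ℤ.* q (suc n) ℤ.+ ((f ∘ suc) · q) n) ℤ.- f 0 ℤ.* q (suc n)
      ≡⟨ cong₂ (λ s c → s ℤ.- c ℤ.* q (suc n)) (eq (suc n)) f₀≡p₀ ⟩
    r n                                                            ∎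
  go : f ≗ p / q
  go zero    = f₀≡p₀
  go (suc n) = /-unique (f ∘ suc) r q tail-eq n

generatingFunction : (ℕ → ℕ) → Series
generatingFunction c n = + c n

{-# OPTIONS --safe #-}
module Submission where

-- Ascent sequences avoiding 021 are the words 0w whose positive letters increase
-- weakly. All that matters about a prefix with largest letter m is its slack
-- asc + 1 - m: a zero keeps it, repeating m raises it by one exactly after a zero,
-- and the letter m + d (1 ≤ d ≤ slack) turns it into slack + 1 - d. A word avoiding
-- τ = 12c0 starts with a block of 0s and 1s; once a letter above 1 has occurred,
-- the first letter of the kind of c (zero, repeated or larger) makes every later 0
-- forbidden. This gives recurrences in the slack and the length. The sum Φ over
-- the initial 0-1-block turns summation over slacks into multiplication by
-- a rational function, so that for each of the three patterns the recurrences close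
-- up at bounded slack, with the common solution
-- b (n + 1) = 2ⁿ + [xⁿ] x² / (1 - 3x + x²)².

open import Defs
open import Data.Bool using (Bool; true; false; if_then_else_)
open import Data.Bool.Properties using (T-≡)
open import Data.Fin using (Fin; zero; suc; toℕ; punchOut; #_) renaming (_<_ to _<ᶠ_)
open import Data.Fin.Properties using (punchIn-punchOut)
open import Data.Integer using (ℤ; +_; -_; 0ℤ; 1ℤ; _+_; _-_; _*_)
import Data.Integer as ℤ
import Data.Integer.Properties as ℤ
open import Data.Integer.Tactic.RingSolver using (solve-∀)
open import Data.List using (List; []; _∷_; _++_; length; lookup; map; take; tabulate)
open import Data.List.Properties using (tabulate-cong; ∷-injectiveˡ; ∷-injectiveʳ; length-++; length-map)
open import Data.List.Membership.Propositional using (_∈_)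
open import Data.List.Membership.Propositional.Properties using (∈-map⁺; ∈-map⁻; ∈-++⁺ˡ; ∈-++⁺ʳ; ∈-++⁻)
open import Data.List.Membership.Propositional.Properties.WithK using (unique∧set⇒bag)
open import Data.List.Relation.Binary.BagAndSetEquality using (∼bag⇒↭)
open import Data.List.Relation.Binary.Permutation.Propositional.Properties using (↭-length)
open import Data.List.Relation.Binary.Sublist.Propositional
  using (_⊆_; _∷_; _∷ʳ_; to∈; from∈; minimum; ⊆-trans; ⊆-refl)
open import Data.List.Relation.Binary.Sublist.Propositional.Properties using (∷ˡ⁻)
open import Data.List.Relation.Unary.All using ([])
open import Data.List.Relation.Unary.AllPairs using ([]; _∷_)
open import Data.List.Relation.Unary.Any using (here; there)
open import Data.List.Relation.Unary.Unique.Propositional using (Unique)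
import Data.List.Relation.Unary.Unique.Propositional.Properties as Unique
open import Data.Maybe using (Maybe; just; nothing; maybe′)
open import Data.Nat using (ℕ; zero; suc; _≤_; _<_; _<ᵇ_; z≤n; s≤s; z<s; s<s; s<s⁻¹; s≤s⁻¹)
import Data.Nat as ℕ
import Data.Nat.Properties as ℕ
open import Data.Product using (∃; ∃₂; _×_; _,_; proj₁; proj₂)
open import Data.Sum using (inj₁; inj₂)
open import Function using (_∘_; _⇔_; mk⇔; Equivalence)
open import Relation.Binary.Definitions using (tri<; tri≈; tri>)
open import Relation.Binary.PropositionalEquality
open import Relation.Nullary using (¬_; contradiction)

open Equivalence using (to; from)

-- Counting continuations

-- The kind of a letter compared with the largest letter so far. As the
-- parameter t it names the pattern 12c0 with c = 0, 2, 3 respectively.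
data Kind : Set where
  zero repeat larger : Kind

-- flat: all letters are 0 or 1; risen: a letter above 1 has occurred;
-- sealed: an occurrence of 12c has been completed, so 0 is forbidden.
data Phase : Set where
  flat risen sealed : Phase

next : Kind → Phase → Kind → Maybe Phase
next t      flat   larger = just risen
next t      flat   _      = just flat
next zero   risen  zero   = just sealed
next repeat risen  repeat = just sealed
next larger risen  larger = just sealed
next t      risen  _      = just risen
next t      sealed zero   = nothing
next t      sealed _      = just sealed

slackAfterRepeat : Bool → ℕ → ℕ
slackAfterRepeat afterZero s = if afterZero then suc s else s

Σ⁺ : (ℕ → ℤ) → ℕ → ℤ
Σ⁺ f zero    = 0ℤ
Σ⁺ f (suc s) = f (suc s) + Σ⁺ f s

-- The number of continuations by n letters, where the next letter may exceed
-- the largest letter so far by at most s.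
count : Kind → Phase → Bool → ℕ → ℕ → ℤ
count t p z s zero    = 1ℤ
count t p z s (suc n) =
  maybe′ (λ p′ → count t p′ true s n) 0ℤ (next t p zero) +
  (maybe′ (λ p′ → count t p′ false (slackAfterRepeat z s) n) 0ℤ (next t p repeat) +
   maybe′ (λ p′ → Σ⁺ (λ j → count t p′ false j n) s) 0ℤ (next t p larger))

-- An entry F s n is the number of ways to continue by n letters with slack s.
Table : Set
Table = ℕ → ℕ → ℤ

ΣT : Table → Table
ΣT F s n = Σ⁺ (λ j → F j n) s

-- Φ F s n is the sum of F s′ (n ∸ 1 ∸ |v|) over all words v of 0s and 1s with
-- |v| < n, where s′ is the slack after v if v follows a letter 1 with slack s.
-- Eliminating the analogous sum after a letter 0 gives the recurrence
-- (1 - x)² Φ F s - x² Φ F (s + 1) = x F s.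
Φ : Table → Table
Φ F s zero          = 0ℤ
Φ F s (suc zero)    = F s 0
Φ F s (suc (suc n)) = (+ 2 * Φ F s (suc n) - Φ F s n) + (Φ F (suc s) n + F s (suc n))

-- The recurrence only looks back in the length, so induction on n for all slacks at once works.
-- Identities about `Φ` thereby reduce to ring identities.
Φ-unique : ∀ (F H : Table) → (∀ s → H s 0 ≡ 0ℤ) → (∀ s → H s 1 ≡ F s 0) →
  (∀ s n → H s (suc (suc n)) ≡ (+ 2 * H s (suc n) - H s n) + (H (suc s) n + F s (suc n))) →
  ∀ s n → H s n ≡ Φ F s n
Φ-unique F H h0 h1 h2 s zero          = h0 s
Φ-unique F H h0 h1 h2 s (suc zero)    = h1 s
Φ-unique F H h0 h1 h2 s (suc (suc n)) = trans (h2 s n)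
  (cong₂ _+_
    (cong₂ (λ x y → + 2 * x - y) (Φ-unique F H h0 h1 h2 s (suc n)) (Φ-unique F H h0 h1 h2 s n))
    (cong (_+ F s (suc n)) (Φ-unique F H h0 h1 h2 (suc s) n)))

Φ-+ : ∀ F G s n → Φ F s n + Φ G s n ≡ Φ (λ s n → F s n + G s n) s n
Φ-+ F G = Φ-unique _ _ (λ _ → refl) (λ _ → refl) λ s n →
  ring (Φ F s (suc n)) (Φ F s n) (Φ F (suc s) n) (F s (suc n))
       (Φ G s (suc n)) (Φ G s n) (Φ G (suc s) n) (G s (suc n))
  where
  ring : ∀ a b c d a′ b′ c′ d′ →
    ((+ 2 * a - b) + (c + d)) + ((+ 2 * a′ - b′) + (c′ + d′)) ≡
    (+ 2 * (a + a′) - (b + b′)) + ((c + c′) + (d + d′))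
  ring = solve-∀

Φ-cong : ∀ {F G} → (∀ s n → F s n ≡ G s n) → ∀ s n → Φ F s n ≡ Φ G s n
Φ-cong {F} {G} eq = Φ-unique G (Φ F) (λ _ → refl) (λ s → eq s 0)
  λ s n → cong (λ x → (+ 2 * Φ F s (suc n) - Φ F s n) + (Φ F (suc s) n + x)) (eq s (suc n))

-- Without dependence on the slack, the terms `- Φ F s n` and `Φ F (suc s) n` cancel, and the
-- recurrence becomes one of first order.
Φ-constant : ∀ f (k : ℕ → ℤ) → k 0 ≡ 0ℤ → (∀ n → k (suc n) ≡ + 2 * k n + f n) →
  ∀ s n → Φ (λ _ → f) s n ≡ k n
Φ-constant f k k0 ks s n = sym (Φ-unique (λ _ → f) (λ _ → k) (λ _ → k0) (λ _ → k1)
    (λ _ n → trans (ks (suc n)) (ring (k (suc n)) (k n) (f (suc n)))) s n)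
  where
  k1 : k 1 ≡ f 0
  k1 = trans (ks 0) (trans (cong (λ x → + 2 * x + f 0) k0) (ℤ.+-identityˡ (f 0)))
  ring : ∀ a b c → + 2 * a + c ≡ (+ 2 * a - b) + (b + c)
  ring = solve-∀

-- Among the words v in the sum, the 2ⁿ of length n leave no letter for `F` and contribute c each;
-- every other word leaves a letter, which turns `F` into `G`.
Φ-shift : ∀ F G c → (∀ s → F s 0 ≡ c) → (∀ s n → F s (suc n) ≡ G s n) →
  ∀ s n → Φ F s (suc n) ≡ Φ G s n + c * (+ 2) ℤ.^ n
Φ-shift F G c F0 Fs s zero          = trans (F0 s) (ring c)
  where
  ring : ∀ c → c ≡ 0ℤ + c * + 1
  ring = solve-∀
Φ-shift F G c F0 Fs s (suc zero)
  rewrite F0 s | Fs s 0 = ring c (G s 0)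
  where
  ring : ∀ c g → (+ 2 * c - 0ℤ) + (0ℤ + g) ≡ g + c * (+ 2 * + 1)
  ring = solve-∀
Φ-shift F G c F0 Fs s (suc (suc n))
  rewrite Φ-shift F G c F0 Fs s (suc n) | Φ-shift F G c F0 Fs s n
        | Φ-shift F G c F0 Fs (suc s) n | Fs s (suc n)
  = ring (Φ G s (suc n)) (Φ G s n) (Φ G (suc s) n) (G s (suc n)) c ((+ 2) ℤ.^ n)
  where
  ring : ∀ x y z g c t →
    (+ 2 * (x + c * (+ 2 * t)) - (y + c * t)) + (z + c * t + g) ≡
    ((+ 2 * x - y) + (z + g)) + c * (+ 2 * (+ 2 * t))
  ring = solve-∀

-- `Φ` is additive and commutes with shifting the slack, since a 0-1-word changes the slack by an
-- amount independent of its initial value.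
Φ-Σ : ∀ F s n → Φ (ΣT F) (suc s) n ≡ Φ F (suc s) n + Φ (ΣT F) s n
Φ-Σ F s zero          = refl
Φ-Σ F s (suc zero)    = refl
Φ-Σ F s (suc (suc n)) rewrite Φ-Σ F s (suc n) | Φ-Σ F (suc s) n | Φ-Σ F s n =
  ring (Φ F (suc s) (suc n)) (Φ (ΣT F) s (suc n)) (Φ F (suc s) n) (Φ (ΣT F) s n)
       (Φ F (suc (suc s)) n) (F (suc s) (suc n)) (ΣT F s (suc n))
  where
  ring : ∀ a b c d e f g →
    (+ 2 * (a + b) - (c + d)) + ((e + (c + d)) + (f + g)) ≡
    ((+ 2 * a - c) + (e + f)) + ((+ 2 * b - d) + ((c + d) + g))
  ring = solve-∀

Φ-Σ-telescope : ∀ F s n → Φ (ΣT F) s n ≡ ΣT (Φ F) s n + Φ (ΣT F) 0 n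
Φ-Σ-telescope F zero    n = sym (ℤ.+-identityˡ _)
Φ-Σ-telescope F (suc s) n = begin
  Φ (ΣT F) (suc s) n                            ≡⟨ Φ-Σ F s n ⟩
  Φ F (suc s) n + Φ (ΣT F) s n                  ≡⟨ cong (λ z → Φ F (suc s) n + z) (Φ-Σ-telescope F s n) ⟩
  Φ F (suc s) n + (ΣT (Φ F) s n + Φ (ΣT F) 0 n) ≡⟨ ℤ.+-assoc (Φ F (suc s) n) _ _ ⟨
  ΣT (Φ F) (suc s) n + Φ (ΣT F) 0 n             ∎
  where open ≡-Reasoning

-- `ΣT F` vanishes at slack 0, and `Φ-Σ` brings the term at slack 1 back to slack 0. This is what
-- keeps the systems of recurrences below finite.
Φ-Σ₀ : ∀ F n → Φ (ΣT F) 0 (suc (suc n)) ≡ + 2 * Φ (ΣT F) 0 (suc n) + Φ F 1 n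
Φ-Σ₀ F n rewrite Φ-Σ F 0 n = ring (Φ (ΣT F) 0 (suc n)) (Φ (ΣT F) 0 n) (Φ F 1 n)
  where
  ring : ∀ a b c → (+ 2 * a - b) + ((c + b) + 0ℤ) ≡ + 2 * a + c
  ring = solve-∀

-- The generating functions of g and h are x / (1 - 3x + x²) and its square.
g : ℕ → ℤ
g zero          = 0ℤ
g (suc zero)    = 1ℤ
g (suc (suc n)) = + 3 * g (suc n) - g n

h : ℕ → ℤ
h zero          = 0ℤ
h (suc zero)    = 0ℤ
h (suc (suc n)) = (+ 3 * h (suc n) - h n) + g (suc n)

-- Closed forms for sealed continuations

module _ (t : Kind) where

  W : Table
  W = count t sealed false

  W-suc : ∀ s n → W s (suc n) ≡ W s n + ΣT W s n
  W-suc s n = ℤ.+-identityˡ _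

  -- At slack 1 the next letter is the repeated one or the single larger one allowed, and both lead
  -- back to slack 1.
  W-one : ∀ n → W 1 n ≡ (+ 2) ℤ.^ n
  W-one zero    = refl
  W-one (suc n) = trans (W-suc 1 n) (trans (cong (λ x → x + (x + 0ℤ)) (W-one n)) (ring ((+ 2) ℤ.^ n)))
    where
    ring : ∀ x → x + (x + 0ℤ) ≡ + 2 * x
    ring = solve-∀

  ΦW₁-suc : ∀ n → Φ W 1 (suc n) ≡ (+ 2 * Φ W 1 n + Φ (ΣT W) 0 n) + (+ 2) ℤ.^ n
  ΦW₁-suc n = begin
    Φ W 1 (suc n)                                       ≡⟨ Φ-shift W _ 1ℤ (λ _ → refl) W-suc 1 n ⟩
    Φ (λ s n → W s n + ΣT W s n) 1 n + 1ℤ * (+ 2) ℤ.^ n   ≡⟨ cong (_+ 1ℤ * (+ 2) ℤ.^ n) (Φ-+ W (ΣT W) 1 n) ⟨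
    Φ W 1 n + Φ (ΣT W) 1 n + 1ℤ * (+ 2) ℤ.^ n             ≡⟨ cong (λ x → Φ W 1 n + x + 1ℤ * (+ 2) ℤ.^ n) (Φ-Σ W 0 n) ⟩
    Φ W 1 n + (Φ W 1 n + Φ (ΣT W) 0 n) + 1ℤ * (+ 2) ℤ.^ n ≡⟨ ring (Φ W 1 n) (Φ (ΣT W) 0 n) ((+ 2) ℤ.^ n) ⟩
    (+ 2 * Φ W 1 n + Φ (ΣT W) 0 n) + (+ 2) ℤ.^ n          ∎
    where
    open ≡-Reasoning
    ring : ∀ a b c → a + (a + b) + 1ℤ * c ≡ (+ 2 * a + b) + c
    ring = solve-∀

  -- Simultaneous induction: `ΦW₁` at n + 1 uses both statements at n, and `ΦΣW₀` at n + 2 uses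
  -- itself at n + 1 and `ΦW₁` at n.
  ΦW₁  : ∀ n → Φ W 1 n ≡ g (suc n) - g n - 1ℤ
  ΦΣW₀ : ∀ n → Φ (ΣT W) 0 n ≡ g n - (+ 2) ℤ.^ n + 1ℤ

  ΦW₁ zero    = refl
  ΦW₁ (suc n) rewrite ΦW₁-suc n | ΦW₁ n | ΦΣW₀ n = ring (g n) (g (suc n)) ((+ 2) ℤ.^ n)
    where
    ring : ∀ a b c → (+ 2 * (b - a - 1ℤ) + (a - c + 1ℤ)) + c ≡ (+ 3 * b - a) - b - 1ℤ
    ring = solve-∀

  ΦΣW₀ zero          = refl
  ΦΣW₀ (suc zero)    = refl
  ΦΣW₀ (suc (suc n)) = begin
    Φ (ΣT W) 0 (suc (suc n))                       ≡⟨ Φ-Σ₀ W n ⟩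
    + 2 * Φ (ΣT W) 0 (suc n) + Φ W 1 n             ≡⟨ cong₂ (λ x y → + 2 * x + y) (ΦΣW₀ (suc n)) (ΦW₁ n) ⟩
    + 2 * (g (suc n) - (+ 2) ℤ.^ suc n + 1ℤ) + (g (suc n) - g n - 1ℤ) ≡⟨ ring (g n) (g (suc n)) ((+ 2) ℤ.^ n) ⟩
    g (suc (suc n)) - (+ 2) ℤ.^ suc (suc n) + 1ℤ     ∎
    where
    open ≡-Reasoning
    ring : ∀ a b c → + 2 * (b - + 2 * c + 1ℤ) + (b - a - 1ℤ) ≡ (+ 3 * b - a) - + 2 * (+ 2 * c) + 1ℤ
    ring = solve-∀

Φ-suc₁ : ∀ F s n → Φ (λ s n → F (suc s) n) s n ≡ Φ F (suc s) n
Φ-suc₁ F s n = sym (Φ-unique (λ s n → F (suc s) n) (λ s n → Φ F (suc s) n)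
  (λ _ → refl) (λ _ → refl) (λ _ _ → refl) s n)

-- P₀ and P₁ count continuations by words of 0s and 1s, after 0 and after 1, with
-- the option of leaving for F at any step.
zeroOneWords : ∀ (P₀ P₁ F : Table) → (∀ s → P₀ s 0 ≡ 1ℤ) → (∀ s → P₁ s 0 ≡ 1ℤ) →
  (∀ s n → P₀ s (suc n) ≡ P₀ s n + (P₁ (suc s) n + F s n)) →
  (∀ s n → P₁ s (suc n) ≡ P₀ s n + (P₁ s n + F s n)) →
  ∀ s n → P₁ s n ≡ (+ 2) ℤ.^ n + Φ F s n
zeroOneWords P₀ P₁ F P₀-0 P₁-0 P₀-suc P₁-suc s n =
  trans (ring₀ (P₁ s n) ((+ 2) ℤ.^ n)) (cong (λ x → (+ 2) ℤ.^ n + x) (Φ-unique F H H-0 H-1 H-suc s n))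
  where
  -- The 2ⁿ words that never leave for `F` are removed. Eliminating `P₀` from the two recurrences
  -- shows that the rest satisfies the recurrence of `Φ`.
  H : Table
  H s n = P₁ s n - (+ 2) ℤ.^ n
  ring₀ : ∀ p t → p ≡ t + (p - t)
  ring₀ = solve-∀
  H-0 : ∀ s → H s 0 ≡ 0ℤ
  H-0 s rewrite P₁-0 s = refl
  H-1 : ∀ s → H s 1 ≡ F s 0
  H-1 s rewrite P₁-suc s 0 | P₀-0 s | P₁-0 s = ring (F s 0)
    where
    ring : ∀ f → (1ℤ + (1ℤ + f)) - + 2 * 1ℤ ≡ f
    ring = solve-∀
  H-suc : ∀ s n → H s (suc (suc n)) ≡ (+ 2 * H s (suc n) - H s n) + (H (suc s) n + F s (suc n))
  H-suc s n rewrite P₁-suc s (suc n) | P₀-suc s n | P₁-suc s n =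
    ring (P₀ s n) (P₁ s n) (P₁ (suc s) n) (F s n) (F s (suc n)) ((+ 2) ℤ.^ n)
    where
    ring : ∀ a b c f f′ t →
      ((a + (c + f)) + ((a + (b + f)) + f′)) - + 2 * (+ 2 * t) ≡
      (+ 2 * ((a + (b + f)) - + 2 * t) - (b - t)) + ((c - t) + f′)
    ring = solve-∀

-- Closed forms for the risen phase, pattern by pattern

Q Q₀ : Kind → Table
Q  t = count t risen false
Q₀ t = count t risen true

-- The right-hand sides do not depend on the pattern; this is where the three counts become equal.
-- The final count uses the second statement, whose induction needs the first.
ΦQ₁-Closed ΦΣQ₀-Closed : Kind → ℕ → Set
ΦQ₁-Closed  t n = Φ (Q t) 1 n ≡ g (suc n) - g n - 1ℤ + h n
ΦΣQ₀-Closed t n = Φ (ΣT (Q t)) 0 n ≡ g n - g (suc n) + 1ℤ + h (suc n) - + 2 * h n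

ΦΣQ₀-closed-suc² : ∀ t n → ΦQ₁-Closed t n → ΦΣQ₀-Closed t (suc n) → ΦΣQ₀-Closed t (suc (suc n))
ΦΣQ₀-closed-suc² t n q σ rewrite Φ-Σ₀ (Q t) n | q | σ = ring (g n) (g (suc n)) (h n) (h (suc n))
  where
  ring : ∀ a b c d →
    + 2 * (b - (+ 3 * b - a) + 1ℤ + ((+ 3 * d - c) + b) - + 2 * d) + (b - a - 1ℤ + c) ≡
    (+ 3 * b - a) - (+ 3 * (+ 3 * b - a) - b) + 1ℤ
      + ((+ 3 * ((+ 3 * d - c) + b) - d) + (+ 3 * b - a)) - + 2 * ((+ 3 * d - c) + b)
  ring = solve-∀

-- The hypothesis and `Φ-Σ₀` form a closed system for the two sequences. The kinds `zero` and
-- `repeat` both fit it.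
closed-from-recurrence : ∀ t →
  (∀ n → Φ (Q t) 1 (suc n) ≡ g (suc n) + (+ 2 * Φ (Q t) 1 n + Φ (ΣT (Q t)) 0 n)) →
  ∀ n → ΦΣQ₀-Closed t n
closed-from-recurrence t rec = σ
  where
  q : ∀ n → ΦQ₁-Closed t n
  σ : ∀ n → ΦΣQ₀-Closed t n
  q zero    = refl
  q (suc n) rewrite rec n | q n | σ n = ring (g n) (g (suc n)) (h n) (h (suc n))
    where
    ring : ∀ a b c d →
      b + (+ 2 * (b - a - 1ℤ + c) + (a - b + 1ℤ + d - + 2 * c)) ≡ (+ 3 * b - a) - b - 1ℤ + d
    ring = solve-∀
  σ zero          = refl
  σ (suc zero)    = refl
  σ (suc (suc n)) = ΦΣQ₀-closed-suc² t n (q n) (σ (suc n))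

closed-zero : ∀ n → ΦΣQ₀-Closed zero n
closed-zero = closed-from-recurrence zero rec
  where
  -- For 1200 the first zero after the rise seals, so `R` counts what follows that zero.
  R : Table
  R = count zero sealed true
  w : Table
  w = W zero
  ΦR₀ : ∀ n → Φ R 0 n ≡ g n
  ΦR₀ zero    = refl
  ΦR₀ (suc n)
    rewrite Φ-shift R (λ s n → w (suc s) n + ΣT w s n) 1ℤ (λ _ → refl) (λ _ _ → ℤ.+-identityˡ _) 0 n
          | sym (Φ-+ (λ s n → w (suc s) n) (ΣT w) 0 n)
          | Φ-suc₁ w 0 n | ΦW₁ zero n | ΦΣW₀ zero n
    = ring (g n) (g (suc n)) ((+ 2) ℤ.^ n)
    where
    ring : ∀ a b t → ((b - a - 1ℤ) + (a - t + 1ℤ)) + 1ℤ * t ≡ b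
    ring = solve-∀
  ΦR₁ : ∀ n → Φ R 1 n ≡ g (suc n) - (+ 2) ℤ.^ n
  ΦR₁ n = begin
    -- The recurrence of `Φ` at slack 0 is solved for its term at slack 1, as the values at slack 0
    -- are known.
    Φ R 1 n
      ≡⟨ ring₁ (Φ R 1 n) (g (suc n)) (g n) (R 0 (suc n)) ⟩
    ((+ 2 * g (suc n) - g n) + (Φ R 1 n + R 0 (suc n))) - (+ 2 * g (suc n) - g n) - R 0 (suc n)
      ≡⟨ cong₂ (λ x y → x - (+ 2 * g (suc n) - g n) - y) ΦR-rec R₀ ⟩
    g (suc (suc n)) - (+ 2 * g (suc n) - g n) - (+ 2) ℤ.^ n
      ≡⟨ ring₂ (g n) (g (suc n)) ((+ 2) ℤ.^ n) ⟩
    g (suc n) - (+ 2) ℤ.^ n ∎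
    where
    open ≡-Reasoning
    R₀ : R 0 (suc n) ≡ (+ 2) ℤ.^ n
    R₀ = trans (ℤ.+-identityˡ _) (trans (ℤ.+-identityʳ _) (W-one zero n))
    ΦR-rec : (+ 2 * g (suc n) - g n) + (Φ R 1 n + R 0 (suc n)) ≡ g (suc (suc n))
    ΦR-rec = trans (sym (cong₂ (λ x y → (+ 2 * x - y) + (Φ R 1 n + R 0 (suc n))) (ΦR₀ (suc n)) (ΦR₀ n)))
                   (ΦR₀ (suc (suc n)))
    ring₁ : ∀ x b a y → x ≡ ((+ 2 * b - a) + (x + y)) - (+ 2 * b - a) - y
    ring₁ = solve-∀
    ring₂ : ∀ a b t → (+ 3 * b - a) - (+ 2 * b - a) - t ≡ b - t
    ring₂ = solve-∀
  rec : ∀ n → Φ (Q zero) 1 (suc n) ≡ g (suc n) + (+ 2 * Φ (Q zero) 1 n + Φ (ΣT (Q zero)) 0 n)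
  rec n
    rewrite Φ-shift (Q zero) (λ s n → R s n + (Q zero s n + ΣT (Q zero) s n)) 1ℤ (λ _ → refl) (λ _ _ → refl) 1 n
          | sym (Φ-+ R (λ s n → Q zero s n + ΣT (Q zero) s n) 1 n)
          | sym (Φ-+ (Q zero) (ΣT (Q zero)) 1 n)
          | Φ-Σ (Q zero) 0 n | ΦR₁ n
    = ring (g (suc n)) ((+ 2) ℤ.^ n) (Φ (Q zero) 1 n) (Φ (ΣT (Q zero)) 0 n)
    where
    ring : ∀ b t q σ → ((b - t) + (q + (q + σ))) + 1ℤ * t ≡ b + (+ 2 * q + σ)
    ring = solve-∀

closed-repeat : ∀ n → ΦΣQ₀-Closed repeat n
closed-repeat = closed-from-recurrence repeat rec
  where
  w q q₀ : Table
  w  = W repeat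
  q  = Q repeat
  q₀ = Q₀ repeat
  Φq-suc : ∀ n → Φ q 1 (suc n) ≡ (Φ q₀ 1 n + (Φ w 1 n + Φ (ΣT q) 1 n)) + 1ℤ * (+ 2) ℤ.^ n
  Φq-suc n
    rewrite Φ-+ w (ΣT q) 1 n | Φ-+ q₀ (λ s n → w s n + ΣT q s n) 1 n
    = Φ-shift q _ 1ℤ (λ _ → refl) (λ _ _ → refl) 1 n
  Φq₀-suc : ∀ n → Φ q₀ 1 (suc n) ≡ (Φ q₀ 1 n + (Φ w 2 n + Φ (ΣT q) 1 n)) + 1ℤ * (+ 2) ℤ.^ n
  Φq₀-suc n
    rewrite sym (Φ-suc₁ w 1 n)
          | Φ-+ (λ s n → w (suc s) n) (ΣT q) 1 n | Φ-+ q₀ (λ s n → w (suc s) n + ΣT q s n) 1 n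
    = Φ-shift q₀ _ 1ℤ (λ _ → refl) (λ _ _ → refl) 1 n
  -- Again the recurrence of `Φ` is solved for its term at the higher slack, now starting from slack
  -- 1.
  Φw₂ : ∀ n → Φ w 2 n ≡ Φ w 1 n + (g (suc n) - (+ 2) ℤ.^ suc n + 1ℤ)
  Φw₂ n = begin
    Φ w 2 n
      ≡⟨ ring₁ (Φ w 2 n) (Φ w 1 (suc n)) (Φ w 1 n) (w 1 (suc n)) ⟩
    Φ w 1 (suc (suc n)) - + 2 * Φ w 1 (suc n) + Φ w 1 n - w 1 (suc n)
      ≡⟨ cong₂ (λ x y → x + Φ w 1 n - y)
           (cong₂ (λ x y → x - + 2 * y) (ΦW₁ repeat (suc (suc n))) (ΦW₁ repeat (suc n))) (W-one repeat (suc n)) ⟩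
    (g (suc (suc (suc n))) - g (suc (suc n)) - 1ℤ)
      - + 2 * (g (suc (suc n)) - g (suc n) - 1ℤ) + Φ w 1 n - (+ 2) ℤ.^ suc n
      ≡⟨ ring₂ (g n) (g (suc n)) (Φ w 1 n) ((+ 2) ℤ.^ suc n) ⟩
    Φ w 1 n + (g (suc n) - (+ 2) ℤ.^ suc n + 1ℤ) ∎
    where
    open ≡-Reasoning
    ring₁ : ∀ x y z v → x ≡ ((+ 2 * y - z) + (x + v)) - + 2 * y + z - v
    ring₁ = solve-∀
    ring₂ : ∀ a b z t →
      ((+ 3 * (+ 3 * b - a) - b) - (+ 3 * b - a) - 1ℤ) - + 2 * ((+ 3 * b - a) - b - 1ℤ) + z - t ≡
      z + (b - t + 1ℤ)
    ring₂ = solve-∀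
  -- The recurrences of `q₀` and `q` differ only after a sealing repeat, where the slack is 2
  -- instead of 1. Their difference at n + 1 is thus that of `Φ w 2 n` and `Φ w 1 n` and does not
  -- accumulate.
  Φq₀ : ∀ n → Φ q₀ 1 n ≡ Φ q 1 n + (g n - (+ 2) ℤ.^ n + 1ℤ)
  Φq₀ zero    = refl
  Φq₀ (suc n) rewrite Φq₀-suc n | Φq-suc n | Φw₂ n =
    ring (Φ q₀ 1 n) (Φ w 1 n) (Φ (ΣT q) 1 n) ((+ 2) ℤ.^ n) (g (suc n) - + 2 * (+ 2) ℤ.^ n + 1ℤ)
    where
    ring : ∀ a b c t d → (a + ((b + d) + c)) + 1ℤ * t ≡ ((a + (b + c)) + 1ℤ * t) + d
    ring = solve-∀
  rec : ∀ n → Φ q 1 (suc n) ≡ g (suc n) + (+ 2 * Φ q 1 n + Φ (ΣT q) 0 n)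
  rec n rewrite Φq-suc n | Φq₀ n | ΦW₁ repeat n | Φ-Σ q 0 n =
    ring (g n) (g (suc n)) ((+ 2) ℤ.^ n) (Φ q 1 n) (Φ (ΣT q) 0 n)
    where
    ring : ∀ a b t q σ →
      ((q + (a - t + 1ℤ)) + ((b - a - 1ℤ) + (q + σ))) + 1ℤ * t ≡ b + (+ 2 * q + σ)
    ring = solve-∀

closed-larger : ∀ n → ΦΣQ₀-Closed larger n
closed-larger = σ
  where
  U K : Table
  U   = Φ (W larger)
  K _ n = g n + 1ℤ
  -- For 1230 zeros and repeats keep the phase risen, so they again form a two-letter block, left
  -- only by a sealing larger letter. The power of 2 cancels, and `K` is the part free of the slack.
  Q-eq : ∀ s n → Q larger s n ≡ ΣT U s n + K s n
  Q-eq s n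
    rewrite zeroOneWords (Q₀ larger) (Q larger) (ΣT (W larger))
              (λ _ → refl) (λ _ → refl) (λ _ _ → refl) (λ _ _ → refl) s n
          | Φ-Σ-telescope (W larger) s n | ΦΣW₀ larger n
    = ring ((+ 2) ℤ.^ n) (ΣT U s n) (g n)
    where
    ring : ∀ t u a → t + (u + (a - t + 1ℤ)) ≡ u + (a + 1ℤ)
    ring = solve-∀
  U-suc : ∀ s n → U s (suc n) ≡ U s n + (ΣT U s n + K s n)
  U-suc s n
    rewrite Φ-shift (W larger) _ 1ℤ (λ _ → refl) (W-suc larger) s n
          | sym (Φ-+ (W larger) (ΣT (W larger)) s n)
          | Φ-Σ-telescope (W larger) s n | ΦΣW₀ larger n
    = ring (U s n) ((+ 2) ℤ.^ n) (ΣT U s n) (g n)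
    where
    ring : ∀ v t u a → (v + (u + (a - t + 1ℤ))) + 1ℤ * t ≡ v + (u + (a + 1ℤ))
    ring = solve-∀
  ΦK : ∀ s n → Φ K s n ≡ g (suc n) - g n - 1ℤ
  ΦK = Φ-constant _ (λ n → g (suc n) - g n - 1ℤ) refl (λ n → ring (g n) (g (suc n)))
    where
    ring : ∀ a b → (+ 3 * b - a) - b - 1ℤ ≡ + 2 * (b - a - 1ℤ) + (a + 1ℤ)
    ring = solve-∀
  -- The linear terms in n are opposite in the two closed forms and vanish in the sum that `q`
  -- needs.
  ΦU₁  : ∀ n → Φ U 1 n ≡ 1ℤ - + n + + 2 * g n - g (suc n) - + 2 * h n + h (suc n)
  ΦΣU₀ : ∀ n → Φ (ΣT U) 0 n ≡ + n - 1ℤ - + 2 * g n + g (suc n) + + 3 * h n - h (suc n)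
  ΦU₁ zero    = refl
  ΦU₁ (suc n)
    rewrite Φ-shift U _ 0ℤ (λ _ → refl) U-suc 1 n
          | sym (Φ-+ U (λ s n → ΣT U s n + K s n) 1 n)
          | sym (Φ-+ (ΣT U) K 1 n) | Φ-Σ U 0 n | ΦK 1 n | ΦU₁ n | ΦΣU₀ n
    = ring (+ n) (g n) (g (suc n)) (h n) (h (suc n)) ((+ 2) ℤ.^ n)
    where
    ring : ∀ m a b c d t →
      ((1ℤ - m + + 2 * a - b - + 2 * c + d)
        + (((1ℤ - m + + 2 * a - b - + 2 * c + d) + (m - 1ℤ - + 2 * a + b + + 3 * c - d))
            + (b - a - 1ℤ))) + 0ℤ * t
      ≡ 1ℤ - (1ℤ + m) + + 2 * b - (+ 3 * b - a) - + 2 * d + ((+ 3 * d - c) + b)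
    ring = solve-∀
  ΦΣU₀ zero          = refl
  ΦΣU₀ (suc zero)    = refl
  ΦΣU₀ (suc (suc n)) =
    trans (Φ-Σ₀ U n)
      (trans (cong₂ (λ x y → + 2 * x + y) (ΦΣU₀ (suc n)) (ΦU₁ n))
        (ring (+ n) (g n) (g (suc n)) (h n) (h (suc n))))
    where
    ring : ∀ m a b c d →
      + 2 * ((1ℤ + m) - 1ℤ - + 2 * b + (+ 3 * b - a) + + 3 * d - ((+ 3 * d - c) + b))
        + (1ℤ - m + + 2 * a - b - + 2 * c + d)
      ≡ (+ 2 + m) - 1ℤ - + 2 * (+ 3 * b - a) + (+ 3 * (+ 3 * b - a) - b)
        + + 3 * ((+ 3 * d - c) + b) - ((+ 3 * ((+ 3 * d - c) + b) - d) + (+ 3 * b - a))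
    ring = solve-∀
  q : ∀ n → ΦQ₁-Closed larger n
  q n
    rewrite Φ-cong Q-eq 1 n | sym (Φ-+ (ΣT U) K 1 n) | Φ-Σ U 0 n | ΦK 1 n | ΦU₁ n | ΦΣU₀ n
    = ring (+ n) (g n) (g (suc n)) (h n) (h (suc n))
    where
    ring : ∀ m a b c d →
      ((1ℤ - m + + 2 * a - b - + 2 * c + d) + (m - 1ℤ - + 2 * a + b + + 3 * c - d)) + (b - a - 1ℤ)
      ≡ b - a - 1ℤ + c
    ring = solve-∀
  σ : ∀ n → ΦΣQ₀-Closed larger n
  σ zero          = refl
  σ (suc zero)    = refl
  σ (suc (suc n)) = ΦΣQ₀-closed-suc² larger n (q n) (σ (suc n))

-- At slack 0 no larger letter can follow, so `P₁ 0 (suc n)` is just `P₀ 0 n + P₁ 0 n`. The count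
-- after a 0 is therefore a difference of two consecutive counts after a 1, which `zeroOneWords`
-- provides.
count-closed : ∀ t n → count t flat true 0 n ≡ (+ 2) ℤ.^ n + h n
count-closed t n = begin
  P₀ 0 n                    ≡⟨ ring₁ (P₀ 0 n) (P₁ 0 n) ⟩
  (P₀ 0 n + (P₁ 0 n + 0ℤ)) - P₁ 0 n
    ≡⟨ cong₂ _-_ (P₁-eq (suc n)) (P₁-eq n) ⟩
  ((+ 2) ℤ.^ suc n + Φ (ΣT (Q t)) 0 (suc n)) - ((+ 2) ℤ.^ n + Φ (ΣT (Q t)) 0 n)
    ≡⟨ cong₂ (λ x y → ((+ 2) ℤ.^ suc n + x) - ((+ 2) ℤ.^ n + y)) (closed t (suc n)) (closed t n) ⟩
  _ ≡⟨ ring₂ (g n) (g (suc n)) (h n) (h (suc n)) ((+ 2) ℤ.^ n) ⟩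
  (+ 2) ℤ.^ n + h n ∎
  where
  open ≡-Reasoning
  P₀ P₁ : Table
  P₀ = count t flat true
  P₁ = count t flat false
  closed : ∀ t n → ΦΣQ₀-Closed t n
  closed zero   = closed-zero
  closed repeat = closed-repeat
  closed larger = closed-larger
  P₁-eq : ∀ n → P₁ 0 n ≡ (+ 2) ℤ.^ n + Φ (ΣT (Q t)) 0 n
  P₁-eq = zeroOneWords P₀ P₁ (ΣT (Q t)) (λ _ → refl) (λ _ → refl) (λ _ _ → refl) (λ _ _ → refl) 0
  ring₁ : ∀ x y → x ≡ (x + (y + 0ℤ)) - y
  ring₁ = solve-∀
  ring₂ : ∀ a b c d t →
    (+ 2 * t + (b - (+ 3 * b - a) + 1ℤ + ((+ 3 * d - c) + b) - + 2 * d))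
      - (t + (a - b + 1ℤ + d - + 2 * c)) ≡ t + c
  ring₂ = solve-∀

-- The generating function of the closed form

·-congʳ : ∀ f {p q} → p ≗ q → f · p ≗ f · q
·-congʳ f eq zero    = cong (λ x → f 0 * x + 0ℤ) (eq 0)
·-congʳ f eq (suc n) = cong₂ (λ x y → f 0 * x + y) (eq (suc n)) (·-congʳ (f ∘ suc) eq n)

poly[]-· : ∀ f n → (poly [] · f) n ≡ 0ℤ
poly[]-· f zero    = refl
poly[]-· f (suc n) = trans (ℤ.+-identityˡ _) (poly[]-· f n)

·-poly[] : ∀ f n → (f · poly []) n ≡ 0ℤ
·-poly[] f zero    = trans (ℤ.+-identityʳ _) (ℤ.*-zeroʳ (f 0))
·-poly[] f (suc n) = cong₂ _+_ (ℤ.*-zeroʳ (f 0)) (·-poly[] (f ∘ suc) n)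

-- The Cauchy product unfolds along its first factor; this peels the second one instead.
·-poly-∷ : ∀ f c cs n → (f · poly (c ∷ cs)) (suc n) ≡ c * f (suc n) + (f · poly cs) n
·-poly-∷ f c cs zero    = ring (f 0) (f 1) c (poly cs 0)
  where
  ring : ∀ x y c d → x * d + (y * c + 0ℤ) ≡ c * y + (x * d + 0ℤ)
  ring = solve-∀
·-poly-∷ f c cs (suc n) =
  trans (cong (λ y → f 0 * poly cs (suc n) + y) (·-poly-∷ (f ∘ suc) c cs n))
        (ring (f 0 * poly cs (suc n)) (c * f (suc (suc n))) (((f ∘ suc) · poly cs) n))
  where
  ring : ∀ x y z → x + (y + z) ≡ y + (x + z)
  ring = solve-∀

-- The coefficient of the product at degree `length cs + n`, where every coefficient of the
-- polynomial meets one of `f` and nothing is truncated.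
dot : List ℤ → Series → ℕ → ℤ
dot []       f n = 0ℤ
dot (c ∷ cs) f n = c * f (suc (length cs ℕ.+ n)) + dot cs f n

·-poly : ∀ f cs n → (f · poly cs) (length cs ℕ.+ n) ≡ dot cs f n
·-poly f []       n = ·-poly[] f n
·-poly f (c ∷ cs) n =
  trans (·-poly-∷ f c cs (length cs ℕ.+ n)) (cong (λ y → c * f (suc (length cs ℕ.+ n)) + y) (·-poly f cs n))

monomial-· : ∀ c f n → (poly (c ∷ []) · f) n ≡ c * f n
monomial-· c f zero    = ℤ.+-identityʳ _
monomial-· c f (suc n) =
  trans (cong (λ y → c * f (suc n) + y) (poly[]-· f n)) (ℤ.+-identityʳ _)

module _ (f : Series) where

  1-3x+x²-· : ∀ n → (poly (+ 1 ∷ - (+ 3) ∷ + 1 ∷ []) · f) (suc (suc n)) ≡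
              f (suc (suc n)) - + 3 * f (suc n) + f n
  1-3x+x²-· n = trans
    (cong (λ y → + 1 * f (suc (suc n)) + (- (+ 3) * f (suc n) + y)) (monomial-· (+ 1) f n))
    (ring (f n) (f (suc n)) (f (suc (suc n))))
    where
    ring : ∀ x y z → + 1 * z + (- (+ 3) * y + + 1 * x) ≡ z - + 3 * y + x
    ring = solve-∀

  1-2x-· : ∀ n → (poly (+ 1 ∷ - (+ 2) ∷ []) · f) (suc n) ≡ f (suc n) - + 2 * f n
  1-2x-· n = trans
    (cong (λ y → + 1 * f (suc n) + y) (monomial-· (- (+ 2)) f n))
    (ring (f n) (f (suc n)))
    where
    ring : ∀ x y → + 1 * y + - (+ 2) * x ≡ y - + 2 * x
    ring = solve-∀

numerator denominator : Series
numerator   = poly (+ 1 ∷ - (+ 7) ∷ + 17 ∷ - (+ 16) ∷ + 5 ∷ - (+ 1) ∷ [])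
denominator = poly (+ 1 ∷ - (+ 2) ∷ []) · poly (+ 1 ∷ - (+ 3) ∷ + 1 ∷ []) ^ 2

denominatorCoefficients : List ℤ
denominatorCoefficients = + 1 ∷ - (+ 8) ∷ + 23 ∷ - (+ 28) ∷ + 13 ∷ - (+ 2) ∷ []

denominator-expanded : denominator ≗ poly denominatorCoefficients
denominator-expanded = eq
  where
  b¹ b² : Series
  b¹ = poly (+ 1 ∷ - (+ 3) ∷ + 1 ∷ []) ^ 1
  b² = poly (+ 1 ∷ - (+ 3) ∷ + 1 ∷ []) ^ 2
  -- The powers have degree 2 and 4, so the whole product has no terms from degree 6 on and the
  -- lower coefficients can be computed.
  b¹-3 : ∀ n → b¹ (suc (suc (suc n))) ≡ 0ℤ
  b¹-3 n = 1-3x+x²-· (poly (1ℤ ∷ [])) (suc n)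
  b²-5 : ∀ n → b² (suc (suc (suc (suc (suc n))))) ≡ 0ℤ
  b²-5 n = trans (1-3x+x²-· b¹ (suc (suc (suc n))))
    (cong₂ _+_ (cong₂ (λ x y → x - + 3 * y) (b¹-3 (suc (suc n))) (b¹-3 (suc n))) (b¹-3 n))
  eq : denominator ≗ poly denominatorCoefficients
  eq 0 = refl
  eq 1 = refl
  eq 2 = refl
  eq 3 = refl
  eq 4 = refl
  eq 5 = refl
  eq (suc (suc (suc (suc (suc (suc n)))))) =
    trans (1-2x-· b² (suc (suc (suc (suc (suc n))))))
      (cong₂ (λ x y → x - + 2 * y) (b²-5 (suc n)) (b²-5 n))

closedForm : Series
closedForm zero    = 1ℤ
closedForm (suc n) = (+ 2) ℤ.^ n + h n

-- The factor 1 - 2x annihilates the powers of 2 and the squared factor annihilates `h`, up to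
-- initial terms. From degree 6 on, all values are expressed through `g` and `h` at n and n + 1,
-- which leaves one ring identity.
closedForm-·-denominator : closedForm · denominator ≗ numerator
closedForm-·-denominator n = trans (·-congʳ closedForm denominator-expanded n) (eq n)
  where
  F : Series
  F = closedForm
  module _ (n : ℕ) where
    x₀ x₁ y₀ y₁ : ℤ
    x₀ = g n
    x₁ = g (suc n)
    y₀ = h n
    y₁ = h (suc n)
    g₃ : g (suc (suc (suc n))) ≡ + 8 * x₁ - + 3 * x₀
    g₃ = ring x₀ x₁
      where
      ring : ∀ a b → + 3 * (+ 3 * b - a) - b ≡ + 8 * b - + 3 * a
      ring = solve-∀
    g₄ : g (suc (suc (suc (suc n)))) ≡ + 21 * x₁ - + 8 * x₀
    g₄ = trans (cong (λ x → + 3 * x - g (suc (suc n))) g₃) (ring x₀ x₁)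
      where
      ring : ∀ a b → + 3 * (+ 8 * b - + 3 * a) - (+ 3 * b - a) ≡ + 21 * b - + 8 * a
      ring = solve-∀
    h₃ : h (suc (suc (suc n))) ≡ + 8 * y₁ - + 3 * y₀ + + 6 * x₁ - x₀
    h₃ = ring x₀ x₁ y₀ y₁
      where
      ring : ∀ a b c d → (+ 3 * ((+ 3 * d - c) + b) - d) + (+ 3 * b - a) ≡ + 8 * d - + 3 * c + + 6 * b - a
      ring = solve-∀
    h₄ : h (suc (suc (suc (suc n)))) ≡ + 21 * y₁ - + 8 * y₀ + + 25 * x₁ - + 6 * x₀
    h₄ = trans (cong₂ (λ x y → (+ 3 * x - h (suc (suc n))) + y) h₃ g₃) (ring x₀ x₁ y₀ y₁)
      where
      ring : ∀ a b c d → (+ 3 * (+ 8 * d - + 3 * c + + 6 * b - a) - ((+ 3 * d - c) + b)) + (+ 8 * b - + 3 * a)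
        ≡ + 21 * d - + 8 * c + + 25 * b - + 6 * a
      ring = solve-∀
    h₅ : h (suc (suc (suc (suc (suc n))))) ≡ + 55 * y₁ - + 21 * y₀ + + 90 * x₁ - + 25 * x₀
    h₅ = trans (cong₂ _+_ (cong₂ (λ x y → + 3 * x - y) h₄ h₃) g₄) (ring x₀ x₁ y₀ y₁)
      where
      ring : ∀ a b c d → (+ 3 * (+ 21 * d - + 8 * c + + 25 * b - + 6 * a) - (+ 8 * d - + 3 * c + + 6 * b - a))
        + (+ 21 * b - + 8 * a) ≡ + 55 * d - + 21 * c + + 90 * b - + 25 * a
      ring = solve-∀
  ring : ∀ t a b c d →
    + 1 * (+ 2 * (+ 2 * (+ 2 * (+ 2 * (+ 2 * t)))) + (+ 55 * d - + 21 * c + + 90 * b - + 25 * a)) +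
    (- (+ 8) * (+ 2 * (+ 2 * (+ 2 * (+ 2 * t))) + (+ 21 * d - + 8 * c + + 25 * b - + 6 * a)) +
    (+ 23 * (+ 2 * (+ 2 * (+ 2 * t)) + (+ 8 * d - + 3 * c + + 6 * b - a)) +
    (- (+ 28) * (+ 2 * (+ 2 * t) + (+ 3 * d - c + b)) +
    (+ 13 * (+ 2 * t + d) + (- (+ 2) * (t + c) + 0ℤ))))) ≡ 0ℤ
  ring = solve-∀
  eq : F · poly denominatorCoefficients ≗ numerator
  eq 0 = refl
  eq 1 = refl
  eq 2 = refl
  eq 3 = refl
  eq 4 = refl
  eq 5 = refl
  eq (suc (suc (suc (suc (suc (suc n)))))) =
    trans (·-poly F denominatorCoefficients n)
      (trans (cong₂ _+_ (cong (λ x → + 1 * ((+ 2) ℤ.^ suc (suc (suc (suc (suc n)))) + x)) (h₅ n))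
             (cong₂ _+_ (cong (λ x → - (+ 8) * ((+ 2) ℤ.^ suc (suc (suc (suc n))) + x)) (h₄ n))
                 (cong (λ x → + 23 * ((+ 2) ℤ.^ suc (suc (suc n)) + x) + rest) (h₃ n))))
             (ring ((+ 2) ℤ.^ n) (g n) (g (suc n)) (h n) (h (suc n))))
    where
    rest : ℤ
    rest = - (+ 28) * F (suc (suc (suc n))) + (+ 13 * F (suc (suc n)) + (- (+ 2) * F (suc n) + 0ℤ))

closedForm≗quotient : closedForm ≗ numerator / denominator
closedForm≗quotient = /-unique closedForm numerator denominator closedForm-·-denominator

-- Pattern occurrences

strictlyIncreasing : ∀ (φ : ℕ → ℕ) → (∀ n → φ n < φ (suc n)) → ∀ {m n} → m < n → φ m < φ n
strictlyIncreasing φ step {m} {suc n} m<1+n with ℕ.m≤n⇒m<n∨m≡n (s≤s⁻¹ m<1+n)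
... | inj₁ m<n  = ℕ.<-trans (strictlyIncreasing φ step m<n) (step n)
... | inj₂ refl = step n

-- A strictly increasing relabelling preserves and, by trichotomy, reflects both order and equality,
-- so a sublist that relabels τ is an occurrence.
contains⁺ : ∀ {π τ} (φ : ℕ → ℕ) → (∀ n → φ n < φ (suc n)) → map φ τ ⊆ π → Contains π τ
contains⁺ {π} {τ} φ step sub = position sub , position-mono sub ,
  (λ j k → mk⇔ (λ lt → reflects-< (subst₂ _<_ (lookup-position sub j) (lookup-position sub k) lt))
               (λ lt → subst₂ _<_ (sym (lookup-position sub j)) (sym (lookup-position sub k))
                         (strictlyIncreasing φ step lt))) ,
  (λ j k → mk⇔ (λ eq → injective (trans (sym (lookup-position sub j)) (trans eq (lookup-position sub k))))
               (λ eq → trans (lookup-position sub j) (trans (cong φ eq) (sym (lookup-position sub k)))))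
  where
  position : ∀ {π τ} → map φ τ ⊆ π → Fin (length τ) → Fin (length π)
  position {τ = _ ∷ _} (_ ∷ʳ p) j      = suc (position p j)
  position {τ = _ ∷ _} (_ ∷ p) zero    = zero
  position {τ = _ ∷ _} (_ ∷ p) (suc j) = suc (position p j)
  position-mono : ∀ {π τ} (p : map φ τ ⊆ π) j k → j <ᶠ k → position p j <ᶠ position p k
  position-mono {τ = _ ∷ _} (_ ∷ʳ p) j       k       lt       = s<s (position-mono p j k lt)
  position-mono {τ = _ ∷ _} (_ ∷ p)  zero    (suc k) lt       = z<s
  position-mono {τ = _ ∷ _} (_ ∷ p)  (suc j) (suc k) (s<s lt) = s<s (position-mono p j k lt)
  lookup-position : ∀ {π τ} (p : map φ τ ⊆ π) j → lookup π (position p j) ≡ φ (lookup τ j)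
  lookup-position {τ = _ ∷ _} (_ ∷ʳ p) j       = lookup-position p j
  lookup-position {τ = _ ∷ _} (eq ∷ p) zero    = sym eq
  lookup-position {τ = _ ∷ _} (_ ∷ p)  (suc j) = lookup-position p j
  reflects-< : ∀ {m n} → φ m < φ n → m < n
  reflects-< {m} {n} lt with ℕ.<-cmp m n
  ... | tri< m<n _ _  = m<n
  ... | tri≈ _ refl _ = contradiction lt (ℕ.<-irrefl refl)
  ... | tri> _ _ n<m  = contradiction lt (ℕ.<-asym (strictlyIncreasing φ step n<m))
  injective : ∀ {m n} → φ m ≡ φ n → m ≡ n
  injective {m} {n} eq with ℕ.<-cmp m n
  ... | tri< m<n _ _ = contradiction eq (ℕ.<⇒≢ (strictlyIncreasing φ step m<n))
  ... | tri≈ _ m≡n _ = m≡n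
  ... | tri> _ _ n<m = contradiction (sym eq) (ℕ.<⇒≢ (strictlyIncreasing φ step n<m))

predecessors : ∀ {m n} (ι : Fin m → Fin (suc n)) → (∀ j → zero {n} <ᶠ ι j) → ∃ λ κ → ι ≗ suc ∘ κ
predecessors {n = n} ι pos = (λ j → punchOut (0≢ j)) , (λ j → sym (punchIn-punchOut (0≢ j)))
  where
  0≢ : ∀ j → zero ≢ ι j
  0≢ j eq = contradiction (subst (zero {n} <ᶠ_) (sym eq) (pos j)) ℕ.n≮0

-- Induction on π: whether or not the first position is the head, all remaining positions lie beyond
-- it and can be shifted down by one.
tabulate-⊆ : ∀ {m} (π : List ℕ) (ι : Fin m → Fin (length π)) →
  (∀ j k → j <ᶠ k → ι j <ᶠ ι k) → tabulate (lookup π ∘ ι) ⊆ π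
tabulate-⊆-tail : ∀ {m} x (π : List ℕ) (ι : Fin m → Fin (suc (length π))) →
  (∀ j → zero {length π} <ᶠ ι j) → (∀ j k → j <ᶠ k → ι j <ᶠ ι k) → tabulate (lookup (x ∷ π) ∘ ι) ⊆ π

tabulate-⊆ {zero}  π       ι mono = minimum π
tabulate-⊆ {suc m} []      ι mono with () ← ι zero
tabulate-⊆ {suc m} (x ∷ π) ι mono with ι zero in eq
... | zero  = refl ∷ tabulate-⊆-tail x π (ι ∘ suc)
                       (λ j → subst (_<ᶠ ι (suc j)) eq (mono zero (suc j) z<s))
                       (λ j k lt → mono (suc j) (suc k) (s<s lt))
... | suc i = x ∷ʳ subst (λ i → lookup (x ∷ π) i ∷ tabulate (lookup (x ∷ π) ∘ ι ∘ suc) ⊆ π) eq (tabulate-⊆-tail x π ι pos mono)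
  where
  pos : ∀ j → zero {length π} <ᶠ ι j
  pos zero    = subst (zero {length π} <ᶠ_) (sym eq) z<s
  pos (suc j) = ℕ.<-trans (pos zero) (mono zero (suc j) z<s)

tabulate-⊆-tail x π ι pos mono with κ , ι≗suc∘κ ← predecessors ι pos =
  subst (_⊆ π) (sym (tabulate-cong (cong (lookup (x ∷ π)) ∘ ι≗suc∘κ)))
    (tabulate-⊆ π κ (λ j k lt → s<s⁻¹ (subst₂ _<ᶠ_ (ι≗suc∘κ j) (ι≗suc∘κ k) (mono j k lt))))

contains⁻ : ∀ {π τ} ((ι , _) : Contains π τ) → tabulate (lookup π ∘ ι) ⊆ π
contains⁻ {π} (ι , mono , _) = tabulate-⊆ π ι mono

-- The positive letters of w increase weakly and are at least suc m.
data Sorted : ℕ → List ℕ → Set where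
  []   : ∀ {m} → Sorted m []
  zero : ∀ {m w} → Sorted m w → Sorted m (0 ∷ w)
  suc  : ∀ {m y w} → m ≤ y → Sorted y w → Sorted m (suc y ∷ w)

sorted⇒≤ : ∀ {m w z} → Sorted m w → suc z ∈ w → m ≤ z
sorted⇒≤ (zero s)    (there z∈)  = sorted⇒≤ s z∈
sorted⇒≤ (suc m≤y s) (here refl) = m≤y
sorted⇒≤ (suc m≤y s) (there z∈)  = ℕ.≤-trans m≤y (sorted⇒≤ s z∈)

sorted⇒no-descent : ∀ {m w y z} → Sorted m w → suc y ∷ suc z ∷ [] ⊆ w → y ≤ z
sorted⇒no-descent (zero s)  (_ ∷ʳ p)   = sorted⇒no-descent s p
sorted⇒no-descent (suc _ s) (_ ∷ʳ p)   = sorted⇒no-descent s p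
sorted⇒no-descent (suc _ s) (refl ∷ p) = sorted⇒≤ s (to∈ p)

-- With `suc m` put in front of w, the lower bound on the first positive letter is itself an
-- instance of the hypothesis.
no-descent⇒sorted : ∀ m w → (∀ {y z} → suc y ∷ suc z ∷ [] ⊆ suc m ∷ w → y ≤ z) → Sorted m w
no-descent⇒sorted m []          ≤ = []
no-descent⇒sorted m (zero ∷ w)  ≤ = zero (no-descent⇒sorted m w (≤ ∘ skip))
  where
  skip : ∀ {u} → u ⊆ suc m ∷ w → u ⊆ suc m ∷ 0 ∷ w
  skip (_ ∷ʳ p) = _ ∷ʳ (_ ∷ʳ p)
  skip (eq ∷ p) = eq ∷ (_ ∷ʳ p)
no-descent⇒sorted m (suc y ∷ w) ≤ =
  suc (≤ (refl ∷ refl ∷ minimum w)) (no-descent⇒sorted y w (≤ ∘ (_ ∷ʳ_)))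

-- The letter of τ between 12 and 0, relative to the letter y playing the role of 2.
Middle : Kind → ℕ → ℕ → Set
Middle zero   y z = z ≡ 0
Middle repeat y z = z ≡ y
Middle larger y z = y < z

pattern-of : Kind → List ℕ
pattern-of zero   = 1 ∷ 2 ∷ 0 ∷ 0 ∷ []
pattern-of repeat = 1 ∷ 2 ∷ 2 ∷ 0 ∷ []
pattern-of larger = 1 ∷ 2 ∷ 3 ∷ 0 ∷ []

-- An occurrence of τ without its first letter, with 2 played by a letter above m and 0 by zero.
TailOccurs : Kind → ℕ → List ℕ → Set
TailOccurs t m w = ∃₂ λ y z → m ≤ y × Middle t (suc y) z × suc y ∷ z ∷ 0 ∷ [] ⊆ w

-- w completes an occurrence of τ after a prefix in the given phase with largest letter suc m.
Bad : Kind → Phase → ℕ → List ℕ → Set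
Bad t flat   m w = TailOccurs t (suc m) w
Bad t risen  m w = TailOccurs t m (suc m ∷ w)
Bad t sealed m w = 0 ∈ w

-- Phases and completed patterns

drop₂ : ∀ {x y a b : ℕ} {u w} → x ∷ y ∷ u ⊆ a ∷ b ∷ w → u ⊆ w
drop₂ (_ ∷ (_ ∷ p))    = p
drop₂ (_ ∷ (_ ∷ʳ p))   = ∷ˡ⁻ p
drop₂ (_ ∷ʳ (_ ∷ p))   = ∷ˡ⁻ p
drop₂ (_ ∷ʳ (_ ∷ʳ p))  = ∷ˡ⁻ (∷ˡ⁻ p)

sealed-by : ∀ t {m} x w → Middle t (suc m) x → TailOccurs t m (suc m ∷ x ∷ w) ⇔ 0 ∈ w
sealed-by t {m} x w mid =
  mk⇔ (λ (_ , _ , _ , _ , p) → to∈ (drop₂ p))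
      (λ 0∈w → m , x , ℕ.≤-refl , mid , refl ∷ refl ∷ from∈ 0∈w)

insert-second : ∀ t {m a w} x → TailOccurs t m (a ∷ w) → TailOccurs t m (a ∷ x ∷ w)
insert-second t x (y , z , le , mid , _ ∷ʳ p) = y , z , le , mid , _ ∷ʳ (_ ∷ʳ p)
insert-second t x (y , z , le , mid , eq ∷ p) = y , z , le , mid , eq ∷ (_ ∷ʳ p)

-- If x occurs in the middle role, the head would play 2, which `¬ Middle` excludes. If x plays 2
-- itself, it equals the head, which can take over.
delete-second : ∀ t {m w} x → ¬ Middle t (suc m) x → (∀ {y} → m ≤ y → x ≡ suc y → y ≡ m) →
  TailOccurs t m (suc m ∷ x ∷ w) → TailOccurs t m (suc m ∷ w)
delete-second t x ¬mid only (y , z , le , mid , eq ∷ (_ ∷ʳ p)) = y , z , le , mid , eq ∷ p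
delete-second t x ¬mid only (y , z , le , mid , refl ∷ (refl ∷ p)) = contradiction mid ¬mid
delete-second t x ¬mid only (y , z , le , mid , _ ∷ʳ (_ ∷ʳ p)) = y , z , le , mid , _ ∷ʳ p
delete-second t x ¬mid only (y , z , le , mid , _ ∷ʳ (eq ∷ p)) with refl ← only le (sym eq) =
  y , z , le , mid , refl ∷ p

-- By sortedness every positive letter of the word is at least `suc y`, so the stronger lower bound
-- on the letter playing 2 is automatic.
raise : ∀ t {m y w} → m ≤ y → Sorted y w → TailOccurs t m (suc y ∷ w) → TailOccurs t y (suc y ∷ w)
raise t m≤y s (y , z , le , mid , refl ∷ p) = y , z , ℕ.≤-refl , mid , refl ∷ p
raise t m≤y s (y , z , le , mid , _ ∷ʳ p)   = y , z , sorted⇒≤ s (to∈ p) , mid , _ ∷ʳ p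

lower : ∀ t {m y w} → m ≤ y → TailOccurs t y w → TailOccurs t m w
lower t m≤y (y , z , le , mid , p) = y , z , ℕ.≤-trans m≤y le , mid , p

weaken : ∀ t {m w} x → TailOccurs t m w → TailOccurs t m (x ∷ w)
weaken t x (y , z , le , mid , p) = y , z , le , mid , x ∷ʳ p

strengthen : ∀ t {m x w} → (∀ {y} → m ≤ y → suc y ≢ x) → TailOccurs t m (x ∷ w) → TailOccurs t m w
strengthen t ≢x (y , z , le , mid , _ ∷ʳ p) = y , z , le , mid , p
strengthen t ≢x (y , z , le , mid , eq ∷ p) = contradiction eq (≢x le)

-- This and the next two lemmas show that `next` tracks the phases correctly. In the risen phase a
-- letter of kind t seals; other letters create no new occurrence, or take over the role of 2.
bad-zero : ∀ t p {p′ m w} → next t p zero ≡ just p′ → Bad t p m (0 ∷ w) ⇔ Bad t p′ m w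
bad-zero t      flat  refl = mk⇔ (strengthen t λ _ ()) (weaken t 0)
bad-zero zero   risen refl = sealed-by zero 0 _ refl
bad-zero repeat risen refl = mk⇔ (delete-second repeat 0 (λ ()) λ _ ()) (insert-second repeat 0)
bad-zero larger risen refl = mk⇔ (delete-second larger 0 (λ ()) λ _ ()) (insert-second larger 0)
bad-zero t      sealed ()

0∈-suc∷ : ∀ {y w} → 0 ∈ suc y ∷ w ⇔ 0 ∈ w
0∈-suc∷ = mk⇔ (λ { (here ()) ; (there 0∈w) → 0∈w }) there

bad-repeat : ∀ t p {p′ m w} → next t p repeat ≡ just p′ → Bad t p m (suc m ∷ w) ⇔ Bad t p′ m w
bad-repeat t      flat   refl = mk⇔ (strengthen t λ { le refl → ℕ.1+n≰n le }) (weaken t _)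
bad-repeat zero   risen  refl = mk⇔ (delete-second zero _ (λ ()) λ { _ refl → refl }) (insert-second zero _)
bad-repeat repeat risen  refl = sealed-by repeat _ _ refl
bad-repeat larger risen  refl = mk⇔ (delete-second larger _ (ℕ.<-irrefl refl) λ { _ refl → refl }) (insert-second larger _)
bad-repeat t      sealed refl = 0∈-suc∷

-- If the larger letter does not seal, it replaces the old largest letter as 2: for 1200 the two
-- zeros are still to come, and for 1220 the old letter cannot recur by sortedness.
bad-larger : ∀ t p {p′ m y w} → next t p larger ≡ just p′ → m < y → Sorted y w →
  Bad t p m (suc y ∷ w) ⇔ Bad t p′ y w
bad-larger t      flat   refl m<y s = mk⇔ (raise t m<y s) (lower t m<y)
bad-larger zero   risen  {m = m} {y} refl m<y s = mk⇔ forward (weaken zero (suc m) ∘ lower zero (ℕ.<⇒≤ m<y))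
  where
  forward : TailOccurs zero m (suc m ∷ suc y ∷ _) → TailOccurs zero y (suc y ∷ _)
  forward (x , z , le , mid , _ ∷ʳ p)         = raise zero (ℕ.<⇒≤ m<y) s (x , z , le , mid , p)
  forward (x , z , le , refl , refl ∷ (_ ∷ʳ p)) = y , 0 , ℕ.≤-refl , refl , refl ∷ p
bad-larger repeat risen  {m = m} {y} refl m<y s = mk⇔ forward (weaken repeat (suc m) ∘ lower repeat (ℕ.<⇒≤ m<y))
  where
  forward : TailOccurs repeat m (suc m ∷ suc y ∷ _) → TailOccurs repeat y (suc y ∷ _)
  forward (x , z , le , mid , _ ∷ʳ p)           = raise repeat (ℕ.<⇒≤ m<y) s (x , z , le , mid , p)
  forward (x , z , le , refl , refl ∷ (refl ∷ p)) = contradiction m<y (ℕ.<-irrefl refl)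
  forward (x , z , le , refl , refl ∷ (_ ∷ʳ p)) = contradiction (sorted⇒≤ s (to∈ p)) (ℕ.<⇒≱ m<y)
bad-larger larger risen  refl m<y s = sealed-by larger _ _ (s<s m<y)
bad-larger t      sealed refl m<y s = 0∈-suc∷

-- Continuations of a prefix

-- The ascent condition on the letters w following a letter x, where k is one
-- more than the number of ascents up to x.
AscentBounded : ℕ → ℕ → List ℕ → Set
AscentBounded k x w = ∀ (i : Fin (length w)) → lookup w i ≤ k ℕ.+ asc (x ∷ take (toℕ i) w)

raiseIf : Bool → ℕ → ℕ
raiseIf ascent k = if ascent then suc k else k

asc-∷∷ : ∀ k x y w → k ℕ.+ asc (x ∷ y ∷ w) ≡ raiseIf (x <ᵇ y) k ℕ.+ asc (y ∷ w)
asc-∷∷ k x y w with x <ᵇ y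
... | true  = ℕ.+-suc k _
... | false = refl

ascentBounded-∷ : ∀ {k x y w} →
  AscentBounded k x (y ∷ w) ⇔ (y ≤ k × AscentBounded (raiseIf (x <ᵇ y) k) y w)
ascentBounded-∷ {k} {x} {y} {w} = mk⇔
  (λ b → subst (y ≤_) (ℕ.+-identityʳ k) (b zero) ,
         λ i → subst (lookup w i ≤_) (asc-∷∷ k x y (take (toℕ i) w)) (b (suc i)))
  (λ { (y≤k , b) zero    → subst (y ≤_) (sym (ℕ.+-identityʳ k)) y≤k
     ; (y≤k , b) (suc i) → subst (lookup w i ≤_) (sym (asc-∷∷ k x y (take (toℕ i) w))) (b i) })

-- Positive letters increase weakly, so the last letter is 0 or the largest letter so far.
lastLetter : Bool → ℕ → ℕ
lastLetter afterZero m = if afterZero then 0 else suc m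

-- w may follow a prefix with largest letter suc m and m + s ascents.
record Good (t : Kind) (p : Phase) (afterZero : Bool) (m s : ℕ) (w : List ℕ) : Set where
  constructor good
  field
    ascentBounded : AscentBounded (suc (m ℕ.+ s)) (lastLetter afterZero m) w
    sorted        : Sorted m w
    avoiding      : ¬ Bad t p m w

good-[] : ∀ t p z m s → Good t p z m s []
good-[] t p z m s = good (λ ()) [] (¬bad p)
  where
  ¬bad : ∀ p → ¬ Bad t p m []
  ¬bad flat   (_ , _ , _ , _ , ())
  ¬bad risen  (_ , _ , _ , _ , _ ∷ ())
  ¬bad risen  (_ , _ , _ , _ , _ ∷ʳ ())

n≮ᵇn : ∀ n → (n <ᵇ n) ≡ false
n≮ᵇn zero    = refl
n≮ᵇn (suc n) = n≮ᵇn n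

good-zero : ∀ t p {p′ z m s w} → next t p zero ≡ just p′ →
  Good t p z m s (0 ∷ w) ⇔ Good t p′ true m s w
good-zero t p {p′} {z} {m} {s} {w} eq = mk⇔
  (λ { (good b (zero s) a) →
       good (subst (λ k → AscentBounded k 0 w) ≡k (proj₂ (to ascentBounded-∷ b))) s (a ∘ from (bad-zero t p eq)) })
  (λ { (good b s a) →
       good (from ascentBounded-∷ (z≤n , subst (λ k → AscentBounded k 0 w) (sym ≡k) b)) (zero s) (a ∘ to (bad-zero t p eq)) })
  where
  ≡k : raiseIf (lastLetter z m <ᵇ 0) (suc (m ℕ.+ s)) ≡ suc (m ℕ.+ s)
  ≡k with lastLetter z m
  ... | zero  = refl
  ... | suc _ = refl

good-repeat : ∀ t p {p′ z m s w} → next t p repeat ≡ just p′ →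
  Good t p z m s (suc m ∷ w) ⇔ Good t p′ false m (slackAfterRepeat z s) w
good-repeat t p {p′} {z} {m} {s} {w} eq = mk⇔
  (λ { (good b (suc _ s) a) →
       good (subst (λ k → AscentBounded k (suc m) w) (≡k z) (proj₂ (to ascentBounded-∷ b))) s
            (a ∘ from (bad-repeat t p eq)) })
  (λ { (good b s a) →
       good (from ascentBounded-∷ (s≤s (ℕ.m≤m+n m _) , subst (λ k → AscentBounded k (suc m) w) (sym (≡k z)) b))
            (suc ℕ.≤-refl s) (a ∘ to (bad-repeat t p eq)) })
  where
  ≡k : ∀ z → raiseIf (lastLetter z m <ᵇ suc m) (suc (m ℕ.+ s)) ≡ suc (m ℕ.+ slackAfterRepeat z s)
  ≡k true  = cong suc (sym (ℕ.+-suc m s))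
  ≡k false = cong (λ c → raiseIf c (suc (m ℕ.+ s))) (n≮ᵇn m)

good-larger : ∀ t p {p′ z m s y j w} → next t p larger ≡ just p′ →
  -- With d = y - m, the equation says that the new slack `suc j` is s + 1 - d, without truncated
  -- subtraction.
  m < y → y ℕ.+ suc j ≡ suc (m ℕ.+ s) →
  Good t p z m s (suc y ∷ w) ⇔ Good t p′ false y (suc j) w
good-larger t p {p′} {z} {m} {s} {y} {j} {w} eq m<y sum = mk⇔
  (λ { (good b (suc _ s) a) →
       good (subst (λ k → AscentBounded k (suc y) w) (≡k z) (proj₂ (to ascentBounded-∷ b))) s
            (a ∘ from (bad-larger t p eq m<y s)) })
  (λ { (good b s a) →
       good (from ascentBounded-∷ (y≤k , subst (λ k → AscentBounded k (suc y) w) (sym (≡k z)) b))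
            (suc (ℕ.<⇒≤ m<y) s) (a ∘ to (bad-larger t p eq m<y s)) })
  where
  y≤k : suc y ≤ suc (m ℕ.+ _)
  y≤k = subst (suc y ≤_) sum (ℕ.m<m+n y z<s)
  ≡k : ∀ z → raiseIf (lastLetter z m <ᵇ suc y) (suc (m ℕ.+ s)) ≡ suc (y ℕ.+ suc j)
  ≡k true  = cong suc (sym sum)
  ≡k false = trans (cong (λ c → raiseIf c (suc (m ℕ.+ s))) (to T-≡ (ℕ.<⇒<ᵇ m<y))) (cong suc (sym sum))

-- Enumeration of continuations

Words : Set
Words = List (List ℕ)

-- Each step to a higher letter costs one unit of slack, so the recursion matches that of `Σ⁺`.
largerRuns : (ℕ → ℕ → Words) → ℕ → ℕ → Words
largerRuns R m zero    = []
largerRuns R m (suc s) = map (suc (suc m) ∷_) (R (suc m) (suc s)) ++ largerRuns R (suc m) s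

-- The branches mirror those of `count`. The parameter m is needed to name the letters, but the
-- number of words depends only on the slack.
runs : Kind → Phase → Bool → ℕ → ℕ → ℕ → Words
runs t p z m s zero    = [] ∷ []
runs t p z m s (suc n) =
  maybe′ (λ p′ → map (0 ∷_) (runs t p′ true m s n)) [] (next t p zero) ++
  (maybe′ (λ p′ → map (suc m ∷_) (runs t p′ false m (slackAfterRepeat z s) n)) [] (next t p repeat) ++
   maybe′ (λ p′ → largerRuns (λ y j → runs t p′ false y j n) m s) [] (next t p larger))

record LargerRun (R : ℕ → ℕ → Words) (m s : ℕ) (w : List ℕ) : Set where
  constructor largerRun
  field
    {y j} : ℕ
    {v}   : List ℕ
    m<y   : m < y
    sum   : y ℕ.+ suc j ≡ suc (m ℕ.+ s)
    v∈    : v ∈ R y (suc j)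
    w≡    : w ≡ suc y ∷ v

∈-largerRuns⁻ : ∀ R m s {w} → w ∈ largerRuns R m s → LargerRun R m s w
∈-largerRuns⁻ R m (suc s) w∈ with ∈-++⁻ (map (suc (suc m) ∷_) (R (suc m) (suc s))) w∈
... | inj₁ w∈ with v , v∈ , refl ← ∈-map⁻ _ w∈ = largerRun (ℕ.n<1+n m) refl v∈ refl
... | inj₂ w∈ with largerRun m<y sum v∈ refl ← ∈-largerRuns⁻ R (suc m) s w∈ =
  largerRun (ℕ.<-trans (ℕ.n<1+n m) m<y) (trans sum (cong suc (sym (ℕ.+-suc m s)))) v∈ refl

∈-largerRuns⁺ : ∀ R m s {y j v} → m < y → y ℕ.+ suc j ≡ suc (m ℕ.+ s) → v ∈ R y (suc j) →
  suc y ∷ v ∈ largerRuns R m s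
∈-largerRuns⁺ R m zero {y} {j} m<y sum v∈ =
  contradiction (subst (suc y ≤_) (trans sum (cong suc (ℕ.+-identityʳ m))) (ℕ.m<m+n y z<s)) (ℕ.<⇒≱ (s<s m<y))
∈-largerRuns⁺ R m (suc s) m<y sum v∈ with ℕ.m≤n⇒m<n∨m≡n m<y
... | inj₁ 1+m<y = ∈-++⁺ʳ (map (suc (suc m) ∷_) (R (suc m) (suc s)))
        (∈-largerRuns⁺ R (suc m) s 1+m<y (trans sum (cong suc (ℕ.+-suc m s))) v∈)
... | inj₂ refl with refl ← ℕ.+-cancelˡ-≡ (suc m) _ _ sum = ∈-++⁺ˡ (∈-map⁺ _ v∈)

unique-largerRuns : ∀ R → (∀ y j → Unique (R y j)) → ∀ m s → Unique (largerRuns R m s)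
unique-largerRuns R R! m zero    = []
unique-largerRuns R R! m (suc s) =
  Unique.++⁺ (Unique.map⁺ ∷-injectiveʳ (R! (suc m) (suc s))) (unique-largerRuns R R! (suc m) s) disjoint
  where
  disjoint : ∀ {w} → ¬ (w ∈ map (suc (suc m) ∷_) (R (suc m) (suc s)) × w ∈ largerRuns R (suc m) s)
  disjoint (w∈ , w∈′) with v , _ , refl ← ∈-map⁻ _ w∈
    with largerRun m<y _ _ eq ← ∈-largerRuns⁻ R (suc m) s w∈′ =
    ℕ.<⇒≢ m<y (ℕ.suc-injective (∷-injectiveˡ eq))

+length-++ : ∀ (us vs : Words) → + length (us ++ vs) ≡ + length us + + length vs
+length-++ us vs = trans (cong (λ l → + l) (length-++ us)) (ℤ.pos-+ (length us) (length vs))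

+length-map : ∀ (f : List ℕ → List ℕ) us {c} → + length us ≡ c → + length (map f us) ≡ c
+length-map f us eq = trans (cong (λ l → + l) (length-map f us)) eq

length-largerRuns : ∀ R f → (∀ y j → + length (R y j) ≡ f j) → ∀ m s → + length (largerRuns R m s) ≡ Σ⁺ f s
length-largerRuns R f eq m zero    = refl
length-largerRuns R f eq m (suc s) = trans
  (+length-++ (map (suc (suc m) ∷_) (R (suc m) (suc s))) (largerRuns R (suc m) s))
  (cong₂ _+_ (+length-map _ (R (suc m) (suc s)) (eq (suc m) (suc s))) (length-largerRuns R f eq (suc m) s))

length-runs : ∀ t p z m s n → + length (runs t p z m s n) ≡ count t p z s n
length-runs t p z m s zero    = refl
length-runs t p z m s (suc n) =
  trans (+length-++ A (B′ ++ C)) (trans (cong (λ c → + length A + c) (+length-++ B′ C))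
    (cong₂ _+_
      (branch (next t p zero) _ _ λ p′ → +length-map _ (runs t p′ true m s n) (length-runs t p′ true m s n))
      (cong₂ _+_
        (branch (next t p repeat) _ _ λ p′ →
           +length-map _ (runs t p′ false m (slackAfterRepeat z s) n) (length-runs t p′ false m (slackAfterRepeat z s) n))
        (branch (next t p larger) _ _ λ p′ →
           length-largerRuns _ _ (λ y j → length-runs t p′ false y j n) m s))))
  where
  A B′ C : Words
  A  = maybe′ (λ p′ → map (0 ∷_) (runs t p′ true m s n)) [] (next t p zero)
  B′ = maybe′ (λ p′ → map (suc m ∷_) (runs t p′ false m (slackAfterRepeat z s) n)) [] (next t p repeat)
  C  = maybe′ (λ p′ → largerRuns (λ y j → runs t p′ false y j n) m s) [] (next t p larger)
  branch : ∀ (q : Maybe Phase) (R : Phase → Words) (f : Phase → ℤ) → (∀ p′ → + length (R p′) ≡ f p′) →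
    + length (maybe′ R [] q) ≡ maybe′ f 0ℤ q
  branch nothing   R f eq = refl
  branch (just p′) R f eq = eq p′

∈-maybe⁻ : ∀ (q : Maybe Phase) {R : Phase → Words} {w} → w ∈ maybe′ R [] q → ∃ λ p′ → q ≡ just p′ × w ∈ R p′
∈-maybe⁻ (just p′) w∈ = p′ , refl , w∈

∈-maybe⁺ : ∀ {q : Maybe Phase} {p′} (R : Phase → Words) {w} → q ≡ just p′ → w ∈ R p′ → w ∈ maybe′ R [] q
∈-maybe⁺ R refl w∈ = w∈

data Step (t : Kind) (p : Phase) (z : Bool) (m s n : ℕ) : List ℕ → Set where
  zero   : ∀ {p′ w} → next t p zero ≡ just p′ → w ∈ runs t p′ true m s n → Step t p z m s n (0 ∷ w)
  repeat : ∀ {p′ w} → next t p repeat ≡ just p′ → w ∈ runs t p′ false m (slackAfterRepeat z s) n →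
           Step t p z m s n (suc m ∷ w)
  larger : ∀ {p′ y j w} → next t p larger ≡ just p′ → m < y → y ℕ.+ suc j ≡ suc (m ℕ.+ s) →
           w ∈ runs t p′ false y (suc j) n → Step t p z m s n (suc y ∷ w)

∈-runs⁻ : ∀ t p z m s n {w} → w ∈ runs t p z m s (suc n) → Step t p z m s n w
∈-runs⁻ t p z m s n w∈ with ∈-++⁻ (maybe′ (λ p′ → map (0 ∷_) (runs t p′ true m s n)) [] (next t p zero)) w∈
... | inj₁ w∈ with p′ , eq , w∈ ← ∈-maybe⁻ (next t p zero) w∈
  with v , v∈ , refl ← ∈-map⁻ _ w∈ = zero eq v∈
... | inj₂ w∈
  with ∈-++⁻ (maybe′ (λ p′ → map (suc m ∷_) (runs t p′ false m (slackAfterRepeat z s) n)) [] (next t p repeat)) w∈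
... | inj₁ w∈ with p′ , eq , w∈ ← ∈-maybe⁻ (next t p repeat) w∈
  with v , v∈ , refl ← ∈-map⁻ _ w∈ = repeat eq v∈
... | inj₂ w∈ with p′ , eq , w∈ ← ∈-maybe⁻ (next t p larger) w∈
  with largerRun m<y sum v∈ refl ← ∈-largerRuns⁻ _ m s w∈ = larger eq m<y sum v∈

∈-runs⁺ : ∀ t p z m s n {w} → Step t p z m s n w → w ∈ runs t p z m s (suc n)
∈-runs⁺ t p z m s n (zero eq w∈)   = ∈-++⁺ˡ (∈-maybe⁺ _ eq (∈-map⁺ _ w∈))
∈-runs⁺ t p z m s n (repeat eq w∈) =
  ∈-++⁺ʳ (maybe′ (λ p′ → map (0 ∷_) (runs t p′ true m s n)) [] (next t p zero))
    (∈-++⁺ˡ (∈-maybe⁺ _ eq (∈-map⁺ _ w∈)))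
∈-runs⁺ t p z m s n (larger eq m<y sum w∈) =
  ∈-++⁺ʳ (maybe′ (λ p′ → map (0 ∷_) (runs t p′ true m s n)) [] (next t p zero))
    (∈-++⁺ʳ (maybe′ (λ p′ → map (suc m ∷_) (runs t p′ false m (slackAfterRepeat z s) n)) [] (next t p repeat))
      (∈-maybe⁺ (λ p′ → largerRuns (λ y j → runs t p′ false y j n) m s) eq (∈-largerRuns⁺ _ m s m<y sum w∈)))

runs-sound : ∀ t p z m s n {w} → w ∈ runs t p z m s n → length w ≡ n × Good t p z m s w
runs-sound t p z m s zero    (here refl) = refl , good-[] t p z m s
runs-sound t p z m s (suc n) w∈ with ∈-runs⁻ t p z m s n w∈
... | zero {p′} eq v∈ with l , g ← runs-sound t p′ true m s n v∈ = cong suc l , from (good-zero t p eq) g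
... | repeat {p′} eq v∈ with l , g ← runs-sound t p′ false m (slackAfterRepeat z s) n v∈ =
  cong suc l , from (good-repeat t p eq) g
... | larger {p′} {y} {j} eq m<y sum v∈ with l , g ← runs-sound t p′ false y (suc j) n v∈ =
  cong suc l , from (good-larger t p eq m<y sum) g

next-positive : ∀ t p k → k ≢ zero → ∃ λ p′ → next t p k ≡ just p′
next-positive t      p      zero   k≢0 = contradiction refl k≢0
next-positive t      flat   repeat _   = flat , refl
next-positive t      flat   larger _   = risen , refl
next-positive zero   risen  repeat _   = risen , refl
next-positive zero   risen  larger _   = risen , refl
next-positive repeat risen  repeat _   = sealed , refl
next-positive repeat risen  larger _   = risen , refl
next-positive larger risen  repeat _   = risen , refl
next-positive larger risen  larger _   = sealed , refl
next-positive t      sealed repeat _   = sealed , refl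
next-positive t      sealed larger _   = sealed , refl

next-zero : ∀ t p {m w} → ¬ Bad t p m (0 ∷ w) → ∃ λ p′ → next t p zero ≡ just p′
next-zero t      flat   _    = flat , refl
next-zero zero   risen  _    = sealed , refl
next-zero repeat risen  _    = risen , refl
next-zero larger risen  _    = risen , refl
next-zero t      sealed ¬bad = contradiction (here refl) ¬bad

runs-complete : ∀ t p z m s w → Good t p z m s w → w ∈ runs t p z m s (length w)
runs-complete t p z m s []         g = here refl
runs-complete t p z m s (zero ∷ w) g with p′ , eq ← next-zero t p (Good.avoiding g) =
  ∈-runs⁺ t p z m s (length w) (zero eq (runs-complete t p′ true m s w (to (good-zero t p eq) g)))
runs-complete t p z m s (suc y ∷ w) g@(good b (suc m≤y _) _) with ℕ.m≤n⇒m<n∨m≡n m≤y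
... | inj₂ refl with p′ , eq ← next-positive t p repeat (λ ()) =
  ∈-runs⁺ t p z m s (length w)
    (repeat eq (runs-complete t p′ false m (slackAfterRepeat z s) w (to (good-repeat t p eq) g)))
... | inj₁ m<y with p′ , eq ← next-positive t p larger (λ ()) =
  ∈-runs⁺ t p z m s (length w)
    (larger eq m<y sum (runs-complete t p′ false y (suc (m ℕ.+ s ℕ.∸ y)) w (to (good-larger t p eq m<y sum) g)))
  where
  -- The ascent condition on the letter `suc y` gives y ≤ m + s, so the truncated subtraction is
  -- exact.
  sum : y ℕ.+ suc (m ℕ.+ s ℕ.∸ y) ≡ suc (m ℕ.+ s)
  sum = trans (ℕ.+-suc y _) (cong suc (ℕ.m+[n∸m]≡n (s≤s⁻¹ (proj₁ (to ascentBounded-∷ b)))))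

unique-runs : ∀ t p z m s n → Unique (runs t p z m s n)
unique-runs t p z m s zero    = [] ∷ []
unique-runs t p z m s (suc n) =
  Unique.++⁺
    (branch (next t p zero) λ p′ → Unique.map⁺ ∷-injectiveʳ (unique-runs t p′ true m s n))
    (Unique.++⁺
      (branch (next t p repeat) λ p′ → Unique.map⁺ ∷-injectiveʳ (unique-runs t p′ false m (slackAfterRepeat z s) n))
      (branch (next t p larger) λ p′ → unique-largerRuns _ (λ y j → unique-runs t p′ false y j n) m s)
      repeat≢larger)
    zero≢positive
  where
  branch : ∀ (q : Maybe Phase) {R : Phase → Words} → (∀ p′ → Unique (R p′)) → Unique (maybe′ R [] q)
  branch nothing   R! = []
  branch (just p′) R! = R! p′
  A B′ C : Words
  A  = maybe′ (λ p′ → map (0 ∷_) (runs t p′ true m s n)) [] (next t p zero)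
  B′ = maybe′ (λ p′ → map (suc m ∷_) (runs t p′ false m (slackAfterRepeat z s) n)) [] (next t p repeat)
  C  = maybe′ (λ p′ → largerRuns (λ y j → runs t p′ false y j n) m s) [] (next t p larger)
  ∈A : ∀ {w} → w ∈ A → ∃ λ v → w ≡ 0 ∷ v
  ∈A w∈ with _ , _ , w∈ ← ∈-maybe⁻ (next t p zero) w∈ with v , _ , eq ← ∈-map⁻ _ w∈ = v , eq
  ∈B : ∀ {w} → w ∈ B′ → ∃ λ v → w ≡ suc m ∷ v
  ∈B w∈ with _ , _ , w∈ ← ∈-maybe⁻ (next t p repeat) w∈ with v , _ , eq ← ∈-map⁻ _ w∈ = v , eq
  ∈C : ∀ {w} → w ∈ C → ∃₂ λ y v → m < y × w ≡ suc y ∷ v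
  ∈C w∈ with _ , _ , w∈ ← ∈-maybe⁻ (next t p larger) w∈
    with largerRun m<y _ _ eq ← ∈-largerRuns⁻ _ m s w∈ = _ , _ , m<y , eq
  repeat≢larger : ∀ {w} → ¬ (w ∈ B′ × w ∈ C)
  repeat≢larger (w∈B , w∈C) with _ , refl ← ∈B w∈B with _ , _ , m<y , eq ← ∈C w∈C =
    ℕ.<⇒≢ m<y (ℕ.suc-injective (∷-injectiveˡ eq))
  zero≢positive : ∀ {w} → ¬ (w ∈ A × w ∈ B′ ++ C)
  zero≢positive (w∈A , w∈) with _ , refl ← ∈A w∈A with ∈-++⁻ B′ w∈
  ... | inj₁ w∈B with () ← proj₂ (∈B w∈B)
  ... | inj₂ w∈C with () ← proj₂ (proj₂ (proj₂ (∈C w∈C)))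

-- Ascent sequences as continuations of the prefix 0

isAscentSequence-0∷ : ∀ {w} → IsAscentSequence (0 ∷ w) ⇔ AscentBounded 1 0 w
isAscentSequence-0∷ {w} = mk⇔
  (λ s i → subst (lookup w i ≤_) (ℕ.+-comm _ 1) (IsAscentSequence.bound s (suc i) z<s))
  (λ b → record
    { first = λ { zero _ → refl }
    ; bound = λ { (suc i) _ → subst (lookup w i ≤_) (ℕ.+-comm 1 _) (b i) } })

-- The relabelling fed to `contains⁺`; beyond 3 it only has to stay strictly increasing.
letters : ℕ → ℕ → ℕ → ℕ → ℕ
letters x y z 0                   = 0
letters x y z 1                   = x
letters x y z 2                   = y
letters x y z (suc (suc (suc n))) = z ℕ.+ n

letters-increasing : ∀ {x y z} → 0 < x → x < y → y < z → ∀ n → letters x y z n < letters x y z (suc n)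
letters-increasing 0<x x<y y<z 0 = 0<x
letters-increasing 0<x x<y y<z 1 = x<y
letters-increasing {z = z} 0<x x<y y<z 2 = subst (_ <_) (sym (ℕ.+-identityʳ z)) y<z
letters-increasing {z = z} 0<x x<y y<z (suc (suc (suc n))) = ℕ.+-monoʳ-< z (ℕ.n<1+n n)

suc∷⊆0∷ : ∀ {x u w} → suc x ∷ u ⊆ 0 ∷ w → suc x ∷ u ⊆ w
suc∷⊆0∷ (_ ∷ʳ p) = p

-- The leading 0 can always play the 0 of 021, so only descents between positive letters matter.
avoids-021⇔sorted : ∀ {w} → Avoids (0 ∷ w) (0 ∷ 2 ∷ 1 ∷ []) ⇔ Sorted 0 w
avoids-021⇔sorted {w} = mk⇔ sorted avoids
  where
  sorted : Avoids (0 ∷ w) (0 ∷ 2 ∷ 1 ∷ []) → Sorted 0 w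
  sorted avoid = no-descent⇒sorted 0 w no-descent
    where
    no-descent : ∀ {y z} → suc y ∷ suc z ∷ [] ⊆ 1 ∷ w → y ≤ z
    -- This 1 is the letter put in front by `no-descent⇒sorted`; no positive letter is smaller.
    no-descent (refl ∷ p) = z≤n
    no-descent (_ ∷ʳ p)   = ℕ.≮⇒≥ λ z<y → avoid
      (contains⁺ _ (letters-increasing z<s (s<s z<y) (ℕ.n<1+n _)) (refl ∷ p))
  no-021 : ∀ {x y z} → Sorted 0 w → x < z → z < y → ¬ (x ∷ y ∷ z ∷ [] ⊆ 0 ∷ w)
  no-021 {y = suc y} {suc z} s x<z z<y p =
    ℕ.<⇒≱ (s<s⁻¹ z<y) (sorted⇒no-descent s (suc∷⊆0∷ (∷ˡ⁻ p)))
  avoids : Sorted 0 w → Avoids (0 ∷ w) (0 ∷ 2 ∷ 1 ∷ [])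
  avoids s c@(_ , _ , lt , _) =
    no-021 s (from (lt (# 0) (# 2)) z<s) (from (lt (# 2) (# 1)) (s<s z<s)) (contains⁻ c)

-- The first positive letter of w is 1, so it can play the role of the first letter of τ.
prepend-1 : ∀ {y u w} → AscentBounded 1 0 w → suc (suc y) ∷ u ⊆ w → 1 ∷ suc (suc y) ∷ u ⊆ w
prepend-1 {w = zero ∷ w}        b (_ ∷ʳ p) = 0 ∷ʳ prepend-1 (proj₂ (to ascentBounded-∷ b)) p
prepend-1 {w = suc zero ∷ w}    b (_ ∷ʳ p) = refl ∷ p
prepend-1 {w = suc (suc x) ∷ w} b p with s≤s () ← proj₁ (to ascentBounded-∷ b)

-- A tail whose 2 is played by a letter above 1 is completed by `prepend-1`. Conversely, the last
-- letter of an occurrence must be 0, since otherwise it would form a descent of positive letters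
-- with the first.
avoids-pattern⇔¬bad : ∀ t {w} → AscentBounded 1 0 w → Sorted 0 w →
  Avoids (0 ∷ w) (pattern-of t) ⇔ (¬ Bad t flat 0 w)
avoids-pattern⇔¬bad t {w} b s = mk⇔ (λ avoid bad → avoid (contains t bad)) (λ ¬bad c → ¬bad (bad t c))
  where
  contains : ∀ t → Bad t flat 0 w → Contains (0 ∷ w) (pattern-of t)
  contains zero   (suc y , _ , _ , refl , p) =
    contains⁺ _ (letters-increasing z<s (s<s z<s) (ℕ.n<1+n _)) (_ ∷ʳ prepend-1 b p)
  contains repeat (suc y , _ , _ , refl , p) =
    contains⁺ _ (letters-increasing z<s (s<s z<s) (ℕ.n<1+n _)) (_ ∷ʳ prepend-1 b p)
  contains larger (suc y , z , _ , y<z , p)  =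
    contains⁺ _ (letters-increasing z<s (s<s z<s) y<z)
      (_ ∷ʳ prepend-1 b (subst (λ z → suc (suc y) ∷ z ∷ 0 ∷ [] ⊆ w) (sym (ℕ.+-identityʳ z)) p))

  tailOccurs : ∀ t {x y z u} → u < x → x < y → (u ≡ 0 → Middle t y z) → x ∷ y ∷ z ∷ u ∷ [] ⊆ 0 ∷ w →
    Bad t flat 0 w
  tailOccurs t {suc x} {suc y} {z} {zero}  u<x x<y mid p =
    y , z , ℕ.≤-trans z<s (s<s⁻¹ x<y) , mid refl , suc∷⊆0∷ (∷ˡ⁻ p)
  tailOccurs t {suc x} {suc y} {z} {suc u} u<x x<y mid p =
    contradiction (sorted⇒no-descent s (⊆-trans (refl ∷ suc y ∷ʳ z ∷ʳ ⊆-refl) (suc∷⊆0∷ p)))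
                  (ℕ.<⇒≱ (s<s⁻¹ u<x))

  bad : ∀ t → Contains (0 ∷ w) (pattern-of t) → Bad t flat 0 w
  bad zero   c@(_ , _ , lt , eq) =
    tailOccurs zero (from (lt (# 3) (# 0)) z<s) (from (lt (# 0) (# 1)) (s<s z<s))
      (trans (from (eq (# 2) (# 3)) refl)) (contains⁻ c)
  bad repeat c@(_ , _ , lt , eq) =
    tailOccurs repeat (from (lt (# 3) (# 0)) z<s) (from (lt (# 0) (# 1)) (s<s z<s))
      (λ _ → from (eq (# 2) (# 1)) refl) (contains⁻ c)
  bad larger c@(_ , _ , lt , eq) =
    tailOccurs larger (from (lt (# 3) (# 0)) z<s) (from (lt (# 0) (# 1)) (s<s z<s))
      (λ _ → from (lt (# 1) (# 2)) (s<s (s<s z<s))) (contains⁻ c)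

-- The prefix 0 is treated as if its largest letter were 1, with slack 0. The first 1 then counts as
-- a repeat after a zero and correctly yields slack 1.
runs-enumeration : ∀ t n → Enumeration (B (pattern-of t) (suc n))
runs-enumeration t n = record
  { elements = map (0 ∷_) (runs t flat true 0 0 n)
  ; unique   = Unique.map⁺ ∷-injectiveʳ (unique-runs t flat true 0 0 n)
  ; exact    = λ a → mk⇔ sound (complete a)
  }
  where
  sound : ∀ {a} → a ∈ map (0 ∷_) (runs t flat true 0 0 n) → B (pattern-of t) (suc n) a
  sound a∈ with w , w∈ , refl ← ∈-map⁻ _ a∈ with l , good b s ¬bad ← runs-sound t flat true 0 0 n w∈ = record
    { length≡n         = cong suc l
    ; isAscentSequence = from isAscentSequence-0∷ b
    ; avoids-021       = from avoids-021⇔sorted s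
    ; avoids-τ         = from (avoids-pattern⇔¬bad t b s) ¬bad
    }
  complete : ∀ a → B (pattern-of t) (suc n) a → a ∈ map (0 ∷_) (runs t flat true 0 0 n)
  complete (x ∷ w) record { length≡n = refl ; isAscentSequence = asc ; avoids-021 = av ; avoids-τ = avτ }
    with refl ← IsAscentSequence.first asc zero refl =
    ∈-map⁺ _ (runs-complete t flat true 0 0 w
      (good bounded s (to (avoids-pattern⇔¬bad t bounded s) avτ)))
    where
    bounded : AscentBounded 1 0 w
    bounded = to isAscentSequence-0∷ asc
    s : Sorted 0 w
    s = to avoids-021⇔sorted av

cardinality-unique : ∀ {A : Set} {P : A → Set} (e e′ : Enumeration P) →
  Enumeration.cardinality e ≡ Enumeration.cardinality e′
cardinality-unique e e′ = ↭-length (∼bag⇒↭ (unique∧set⇒bag (unique e) (unique e′)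
  (λ {x} → mk⇔ (from (exact e′ x) ∘ to (exact e x)) (from (exact e x) ∘ to (exact e′ x)))))
  where open Enumeration

b-closedForm : ∀ t → generatingFunction (b (pattern-of t)) ≗ closedForm
b-closedForm zero   zero = refl
b-closedForm repeat zero = refl
b-closedForm larger zero = refl
b-closedForm t (suc n) = begin
  + b (pattern-of t) (suc n) ≡⟨ cong (λ c → + c) (cardinality-unique (B-enumeration _ _) (runs-enumeration t n)) ⟩
  + length (map (0 ∷_) (runs t flat true 0 0 n)) ≡⟨ +length-map _ (runs t flat true 0 0 n) (length-runs t flat true 0 0 n) ⟩
  count t flat true 0 n                         ≡⟨ count-closed t n ⟩
  closedForm (suc n)                            ∎
  where open ≡-Reasoning

theorem2p10 : (τ : List ℕ) →
    τ ∈ (1 ∷ 2 ∷ 0 ∷ 0 ∷ []) ∷ (1 ∷ 2 ∷ 2 ∷ 0 ∷ []) ∷ (1 ∷ 2 ∷ 3 ∷ 0 ∷ []) ∷ [] →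
    generatingFunction (b τ) ≗
    poly (+ 1 ∷ - (+ 7) ∷ + 17 ∷ - (+ 16) ∷ + 5 ∷ - (+ 1) ∷ [])
    / (poly (+ 1 ∷ - (+ 2) ∷ []) · poly (+ 1 ∷ - (+ 3) ∷ + 1 ∷ []) ^ 2)
theorem2p10 _ (here refl)                 n = trans (b-closedForm zero n) (closedForm≗quotient n)
theorem2p10 _ (there (here refl))         n = trans (b-closedForm repeat n) (closedForm≗quotient n)
theorem2p10 _ (there (there (here refl))) n = trans (b-closedForm larger n) (closedForm≗quotient n)
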